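{- For any integers $s\ge 2$ and $n\ge k+1$ (with $k\ge 1$), $$ex(n,K_s,\mathcal{L}_{n,k})=\max\left\{\binom{k}{s},\ \binom{\left\lceil\frac{k+1}{2}\right\rceil}{s}+\left(n-\left\lceil\frac{k+1}{2}\right\rceil\right)\binom{\left\lfloor\frac{k-1}{2}\right\rfloor}{s-1}\right\}.$$
   Context: All graphs are simple. For a family of graphs $\mathcal{F}$, a graph $G$ is $\mathcal{F}$-free if no subgraph of $G$ is isomorphic to a member of $\mathcal{F}$. For a graph $T$, $ex(n,T,\mathcal{F})$ denotes the maximum number of (not necessarily induced) copies of $T$ in an $\mathcal{F}$-free graph on $n$ vertices. A linear forest is a graph whose connected components are all paths or isolated vertices. $\mathcal{L}_{n,k}$ denotes the family of all linear forests on $n$ vertices with exactly $k$ edges. $K_s$ is the complete graph on $s$ vertices. -}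

module Defs where

open import Data.Bool using (Bool; true; false; _∧_; _∨_; not; if_then_else_)
open import Data.Nat using (ℕ; zero; suc; _+_; _*_; _∸_; _≤_; _⊔_; ⌈_/2⌉; ⌊_/2⌋)
open import Data.Nat.Combinatorics using (_C_)
open import Data.Fin using (Fin; _≟_)
open import Data.Vec using (Vec; []; _∷_; lookup; count)
open import Data.List using (List; []; _∷_; length; map; concat; filter; allFin)
open import Data.Nat.ListAction using (sum)
open import Data.Bool.ListAction using (all)
open import Data.List.Relation.Unary.Unique.Propositional using (Unique)
open import Data.Product using (Σ; _×_; ∃-syntax)
open import Relation.Binary.PropositionalEquality using (_≡_)
open import Relation.Nullary using (¬_; does)
open import Relation.Nullary.Decidable using (⌊_⌋)
open import Relation.Unary using (Pred)
import Data.Bool.Properties as BoolP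

record SimpleGraph (n : ℕ) : Set where
  field
    adj    : Fin n → Fin n → Bool
    sym    : ∀ u v → adj u v ≡ adj v u
    irrefl : ∀ v → adj v v ≡ false
open SimpleGraph public

allSubsets : (n : ℕ) → List (Vec Bool n)
allSubsets zero    = [] ∷ []
allSubsets (suc n) = map (true ∷_) (allSubsets n) Data.List.++ map (false ∷_) (allSubsets n)

isClique : ∀ {n} → SimpleGraph n → Vec Bool n → Bool
isClique {n} G S =
  all (λ u → all (λ v →
         not (lookup S u ∧ lookup S v ∧ not ⌊ u ≟ v ⌋) ∨ adj G u v)
       (allFin n)) (allFin n)

size : ∀ {n} → Vec Bool n → ℕ
size S = count (λ b → b BoolP.≟ true) S

isKsCopy : ∀ {n} → ℕ → SimpleGraph n → Vec Bool n → Bool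
isKsCopy s G S = ⌊ size S Data.Nat.≟ s ⌋ ∧ isClique G S

-- Number of copies of K_s in G (a copy of K_s is determined by its
-- s-element vertex set, all of whose pairs are edges).
numKs : ∀ {n} → ℕ → SimpleGraph n → ℕ
numKs s G = length (filter (λ S → isKsCopy s G S BoolP.≟ true) (allSubsets _))

-- A path in G: a list of vertices, consecutive ones adjacent in G.
-- (Distinctness of vertices is imposed globally below.)
IsWalk : ∀ {n} → SimpleGraph n → List (Fin n) → Set
IsWalk G []           = Data.Unit.⊤ where import Data.Unit
IsWalk G (u ∷ [])     = Data.Unit.⊤ where import Data.Unit
IsWalk G (u ∷ v ∷ ps) = (adj G u v ≡ true) × IsWalk G (v ∷ ps)

AllWalks : ∀ {n} → SimpleGraph n → List (List (Fin n)) → Set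
AllWalks G []       = Data.Unit.⊤ where import Data.Unit
AllWalks G (p ∷ ps) = IsWalk G p × AllWalks G ps

pathEdges : ∀ {A : Set} → List A → ℕ
pathEdges p = length p ∸ 1

-- G (on n vertices) contains a member of L_{n,k} as a subgraph:
-- there are vertex-disjoint paths in G (vertices pairwise distinct
-- across all paths) with k edges in total; the remaining vertices of
-- G serve as the isolated vertices, so the linear forest has exactly
-- n vertices.
ContainsLinearForest : ∀ {n} → ℕ → SimpleGraph n → Set
ContainsLinearForest k G =
  Σ (List (List (Fin _))) λ ps → (AllWalks G ps × Unique (concat ps) × sum (map pathEdges ps) ≡ k)

LFree : ∀ {n} → ℕ → SimpleGraph n → Set
LFree k G = ¬ ContainsLinearForest k G

bound : ℕ → ℕ → ℕ → ℕ
bound n k s =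
  (k C s) ⊔ ((⌈ suc k /2⌉ C s) + (n ∸ ⌈ suc k /2⌉) * (⌊ k ∸ 1 /2⌋ C (s ∸ 1)))

{-# OPTIONS --safe #-}

-- Upper bound. If u and v are non-adjacent and deg u + deg v ≥ k, then adding the edge uv creates
-- no linear forest with k edges (Bondy–Chvátal), so one may assume deg u + deg v < k for every
-- non-edge. Take a non-edge uv with deg u + deg v maximal and h = deg u ≤ deg v. All non-neighbours
-- of v have degree at most h, and there are at least n − k + h of them besides v; a K_s either
-- contains one of these n − k + h vertices or lies among the remaining k − h, whence at most
--   f(h) = C(k − h, s) + (n − k + h) C(h, s − 1)
-- copies. As f is convex and 2h < k, the maximum is attained at h = 0 or h = ⌊(k − 1)/2⌋.
--
-- Lower bound. The join of K_h with the disjoint union of K_{k−2h} and n − k + h isolated vertices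
-- has f(h) copies of K_s. Give the vertices of the three parts the weights 2, 1, 0. Every path has
-- at most as many edges as its weight, with strict inequality if it meets K_{k−2h}, and the total
-- weight is k.
module Submission where

open import Defs hiding (sym)
open import Data.Bool using (Bool; true; false; _∧_; _∨_; not; if_then_else_)
import Data.Bool.Properties as Bool
open import Data.Bool.ListAction using (all)
open import Data.Fin using (Fin; zero; suc; _≟_; _↑ʳ_)
open import Data.Fin.Properties using (any?)
open import Data.List
  using (List; []; _∷_; _++_; map; length; filter; allFin; reverse; concat; cartesianProduct)
open import Data.List.Extrema.Nat using (argmax; argmax-all; f[xs]≤f[argmax])
open import Data.List.Properties
  using (++-assoc; reverse-++; unfold-reverse; map-tabulate; length-tabulate)
open import Data.List.Membership.Propositional using (_∈_; _∉_)
open import Data.List.Membership.Propositional.Properties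
  using (∈-allFin; ∈-∃++; ∈-++⁺ˡ; ∈-++⁺ʳ; ∈-++⁻; ∈-filter⁺; ∈-cartesianProduct⁺)
open import Data.List.Relation.Unary.Any using (here; there)
open import Data.List.Relation.Unary.All as All using (All; []; _∷_)
open import Data.List.Relation.Unary.All.Properties using (all-filter)
open import Data.List.Relation.Unary.AllPairs using ([]; _∷_)
open import Data.List.Relation.Unary.Unique.Propositional using (Unique)
open import Data.List.Relation.Unary.Unique.Propositional.Properties using (allFin⁺)
open import Data.List.Relation.Binary.Permutation.Propositional
  using (_↭_; ↭-refl; ↭-sym; ↭-trans; prep; ↭⇒↭ₛ; ↭-reflexive)
open import Data.List.Relation.Binary.Permutation.Propositional.Properties
  using (shift; ++⁺ˡ; ++⁺ʳ; ↭-reverse; map⁺)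
import Data.List.Relation.Binary.Permutation.Setoid.Properties as Permutation
open import Data.Nat as ℕ hiding (_≟_)
open import Data.Nat.Combinatorics using (_C_; nCk+nC[k+1]≡[n+1]C[k+1])
open import Data.Nat.Properties hiding (_≟_)
open import Data.Nat.ListAction using (sum)
open import Data.Nat.ListAction.Properties using (sum-↭)
open import Data.Nat.Tactic.RingSolver using (solve-∀)
open import Data.Product using (Σ; ∃; ∃₂; _×_; _,_; proj₁; proj₂)
open import Data.Sum using (_⊎_; inj₁; inj₂)
open import Data.Unit using (tt)
open import Data.Vec as Vec using (Vec; []; _∷_; lookup; _[_]≔_)
open import Data.Vec.Properties
  using (lookup∘updateAt; lookup∘updateAt′; lookup∘tabulate; lookup-map; lookup-++ʳ;
         []≔-idempotent; []≔-lookup)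
open import Data.Vec.Membership.Propositional.Properties using (∈-lookup)
open import Data.Vec.Relation.Unary.All as VecAll using ([]; _∷_)
open import Data.Vec.Relation.Unary.All.Properties using (++⁺)
open import Function using (_∘_)
open import Relation.Binary.PropositionalEquality hiding ([_])
open import Relation.Nullary
open import Relation.Nullary.Decidable using (⌊_⌋; isYes≗does; _×-dec_; ¬?)

private variable
  A B : Set
  n : ℕ

-- Finite sums over lists.

∑ : (A → ℕ) → List A → ℕ
∑ f xs = sum (map f xs)

∑-mono : {f g : A → ℕ} → (∀ x → f x ≤ g x) → ∀ xs → ∑ f xs ≤ ∑ g xs
∑-mono f≤g []       = z≤n
∑-mono f≤g (x ∷ xs) = +-mono-≤ (f≤g x) (∑-mono f≤g xs)

∑-mono-< : {f g : A → ℕ} → (∀ x → f x ≤ g x) → ∀ {xs y} → y ∈ xs → f y < g y →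
           ∑ f xs < ∑ g xs
∑-mono-< f≤g {x ∷ xs} (here refl) f<g = +-mono-<-≤ f<g (∑-mono f≤g xs)
∑-mono-< f≤g {x ∷ xs} (there y∈)  f<g = +-mono-≤-< (f≤g x) (∑-mono-< f≤g y∈ f<g)

∑-cong : {f g : A → ℕ} → (∀ x → f x ≡ g x) → ∀ xs → ∑ f xs ≡ ∑ g xs
∑-cong f≡g []       = refl
∑-cong f≡g (x ∷ xs) = cong₂ _+_ (f≡g x) (∑-cong f≡g xs)

∑-+ : (f g : A → ℕ) → ∀ xs → ∑ (λ x → f x + g x) xs ≡ ∑ f xs + ∑ g xs
∑-+ f g []       = refl
∑-+ f g (x ∷ xs) = trans (cong (f x + g x +_) (∑-+ f g xs)) (interchange (f x) (g x) _ _)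
  where
  interchange : ∀ a b c d → a + b + (c + d) ≡ a + c + (b + d)
  interchange = solve-∀

∑-*ʳ : (f : A → ℕ) (c : ℕ) → ∀ xs → ∑ (λ x → f x * c) xs ≡ ∑ f xs * c
∑-*ʳ f c []       = refl
∑-*ʳ f c (x ∷ xs) = trans (cong (f x * c +_) (∑-*ʳ f c xs)) (sym (*-distribʳ-+ c (f x) _))

∑-zero : (xs : List A) → ∑ (λ _ → 0) xs ≡ 0
∑-zero []       = refl
∑-zero (x ∷ xs) = ∑-zero xs

∑-swap : (f : A → B → ℕ) → ∀ xs ys → ∑ (λ x → ∑ (f x) ys) xs ≡ ∑ (λ y → ∑ (λ x → f x y) xs) ys
∑-swap f []       ys = sym (∑-zero ys)
∑-swap f (x ∷ xs) ys =
  trans (cong (∑ (f x) ys +_) (∑-swap f xs ys)) (sym (∑-+ (f x) _ ys))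

∑-++ : (f : A → ℕ) → ∀ xs ys → ∑ f (xs ++ ys) ≡ ∑ f xs + ∑ f ys
∑-++ f []       ys = refl
∑-++ f (x ∷ xs) ys = trans (cong (f x +_) (∑-++ f xs ys)) (sym (+-assoc (f x) _ _))

∑-map : (f : B → ℕ) (g : A → B) → ∀ xs → ∑ f (map g xs) ≡ ∑ (f ∘ g) xs
∑-map f g []       = refl
∑-map f g (x ∷ xs) = cong (f (g x) +_) (∑-map f g xs)

∑-↭ : (f : A → ℕ) {xs ys : List A} → xs ↭ ys → ∑ f xs ≡ ∑ f ys
∑-↭ f p = sum-↭ (map⁺ f p)

∑-∈ : (f : A → ℕ) → ∀ {xs y} → y ∈ xs → f y ≤ ∑ f xs
∑-∈ f {x ∷ xs} (here refl) = m≤m+n (f x) _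
∑-∈ f {x ∷ xs} (there y∈)  = ≤-trans (∑-∈ f y∈) (m≤n+m _ (f x))

-- One occurrence of the head is deleted from `ys`; since `xs` has no repetitions, its tail avoids
-- the head and still lies in what is left. This is what bounds a sum over distinct vertices by the
-- sum over all of them.
unique-complement : {xs ys : List A} → Unique xs → (∀ {x} → x ∈ xs → x ∈ ys) →
                    ∃ λ zs → xs ++ zs ↭ ys
unique-complement {ys = ys} []           xs⊆ys = ys , ↭-refl
unique-complement {xs = x ∷ xs} (x∉xs ∷ u) xs⊆ys with ∈-∃++ (xs⊆ys (here refl))
... | ps , qs , refl with unique-complement {ys = ps ++ qs} u avoid
  where
  avoid : ∀ {z} → z ∈ xs → z ∈ ps ++ qs
  avoid z∈xs with ∈-++⁻ ps (xs⊆ys (there z∈xs))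
  ... | inj₁ z∈ps           = ∈-++⁺ˡ z∈ps
  ... | inj₂ (here refl)    = contradiction refl (All.lookup x∉xs z∈xs)
  ... | inj₂ (there z∈qs)   = ∈-++⁺ʳ ps z∈qs
... | zs , p = zs , ↭-trans (prep x p) (↭-sym (shift x ps qs))

unique-sum-≤ : (f : Fin n → ℕ) {xs : List (Fin n)} → Unique xs → ∑ f xs ≤ ∑ f (allFin n)
unique-sum-≤ f {xs} u with unique-complement u (λ {x} _ → ∈-allFin x)
... | zs , p = ≤-trans (m≤m+n (∑ f xs) (∑ f zs)) (≤-reflexive (trans (sym (∑-++ f xs zs)) (∑-↭ f p)))

𝟙 : Bool → ℕ
𝟙 b = if b then 1 else 0

𝟙≤1 : ∀ b → 𝟙 b ≤ 1
𝟙≤1 true  = ≤-refl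
𝟙≤1 false = z≤n

𝟙-mono : ∀ {a b} → (a ≡ true → b ≡ true) → 𝟙 a ≤ 𝟙 b
𝟙-mono {false}     _ = z≤n
𝟙-mono {true}  {b} p rewrite p refl = ≤-refl

-- Reversals of segments in an ordering of the vertices.

links : (A → A → ℕ) → List A → ℕ
links f []           = 0
links f (x ∷ [])     = 0
links f (x ∷ y ∷ xs) = f x y + links f (y ∷ xs)

links-split : (f : A → A → ℕ) → ∀ xs y ys →
              links f (xs ++ y ∷ ys) ≡ links f (xs ++ y ∷ []) + links f (y ∷ ys)
links-split f []           y ys = refl
links-split f (x ∷ [])     y ys = cong (_+ links f (y ∷ ys)) (sym (+-identityʳ (f x y)))
links-split f (x ∷ z ∷ xs) y ys =
  trans (cong (f x z +_) (links-split f (z ∷ xs) y ys)) (sym (+-assoc (f x z) _ _))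

module Rotation {A : Set} (f : A → A → ℕ) (f-sym : ∀ x y → f x y ≡ f y x)
                (f-irrefl : ∀ x → f x x ≡ 0) where

  links-reverse : ∀ xs → links f (reverse xs) ≡ links f xs
  links-reverse []           = refl
  links-reverse (x ∷ [])     = refl
  links-reverse (x ∷ y ∷ xs) = begin
    links f (reverse (x ∷ y ∷ xs))
      ≡⟨ cong (links f) (trans (unfold-reverse x (y ∷ xs)) (cong (_++ x ∷ []) (unfold-reverse y xs))) ⟩
    links f ((reverse xs ++ y ∷ []) ++ x ∷ [])
      ≡⟨ cong (links f) (++-assoc (reverse xs) _ _) ⟩
    links f (reverse xs ++ y ∷ x ∷ [])
      ≡⟨ links-split f (reverse xs) y (x ∷ []) ⟩
    links f (reverse xs ++ y ∷ []) + (f y x + 0)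
      ≡⟨ cong₂ _+_ (cong (links f) (sym (unfold-reverse y xs))) (trans (+-identityʳ _) (f-sym y x)) ⟩
    links f (reverse (y ∷ xs)) + f x y
      ≡⟨ cong (_+ f x y) (links-reverse (y ∷ xs)) ⟩
    links f (y ∷ xs) + f x y
      ≡⟨ +-comm _ (f x y) ⟩
    f x y + links f (y ∷ xs) ∎
    where open ≡-Reasoning

  reverse-segment : ∀ (y : A) xs u → reverse (y ∷ xs ++ u ∷ []) ≡ u ∷ reverse xs ++ y ∷ []
  reverse-segment y xs u =
    trans (reverse-++ (y ∷ xs) (u ∷ [])) (cong (u ∷_) (unfold-reverse y xs))

  -- For `f` an adjacency indicator, these are the orderings whose linear forest has the most edges.
  -- Reversing a segment of such an ordering cannot gain a link, and each inequality below comes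
  -- from one such reversal.
  Optimal : List A → Set
  Optimal L = ∀ L′ → L′ ↭ L → links f L′ ≤ links f L

  Optimal-reverse : ∀ {L} → Optimal L → Optimal (reverse L)
  Optimal-reverse {L} opt L′ p =
    ≤-trans (opt L′ (↭-trans p (↭-reverse L))) (≤-reflexive (sym (links-reverse L)))

  links-segment : ∀ y xs u v zs →
    links f (y ∷ xs ++ u ∷ v ∷ zs) ≡ links f (y ∷ xs ++ u ∷ []) + (f u v + links f (v ∷ zs))
  links-segment y xs u v zs = links-split f (y ∷ xs) u (v ∷ zs)

  links-infix : ∀ ws x y xs u v zs →
    links f (ws ++ x ∷ y ∷ xs ++ u ∷ v ∷ zs) ≡
    links f (ws ++ x ∷ []) + (f x y + (links f (y ∷ xs ++ u ∷ []) + (f u v + links f (v ∷ zs))))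
  links-infix ws x y xs u v zs =
    trans (links-split f ws x _)
          (cong (λ e → links f (ws ++ x ∷ []) + (f x y + e)) (links-segment y xs u v zs))

  flip-↭ : ∀ (y : A) xs u zs → u ∷ reverse xs ++ y ∷ zs ↭ y ∷ xs ++ u ∷ zs
  flip-↭ y xs u zs = ↭-trans (↭-reflexive (sym eq₁)) (↭-trans (++⁺ʳ zs (↭-reverse (y ∷ xs ++ u ∷ []))) (↭-reflexive eq₂))
    where
    eq₁ : reverse (y ∷ xs ++ u ∷ []) ++ zs ≡ u ∷ reverse xs ++ y ∷ zs
    eq₁ = trans (cong (_++ zs) (reverse-segment y xs u)) (cong (u ∷_) (++-assoc (reverse xs) _ _))
    eq₂ : (y ∷ xs ++ u ∷ []) ++ zs ≡ y ∷ xs ++ u ∷ zs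
    eq₂ = cong (y ∷_) (++-assoc xs _ _)

  links-flip : ∀ y xs u → links f (u ∷ reverse xs ++ y ∷ []) ≡ links f (y ∷ xs ++ u ∷ [])
  links-flip y xs u =
    trans (cong (links f) (sym (reverse-segment y xs u))) (links-reverse (y ∷ xs ++ u ∷ []))

  module _ {u v : A} (u≁v : f u v ≡ 0) (zs : List A) where

    -- Reversing the segment from y to u replaces the consecutive pairs xy and uv by xu and yv.
    exchange : ∀ ws x y xs → Optimal (ws ++ x ∷ y ∷ xs ++ u ∷ v ∷ zs) → f u x + f v y ≤ f x y
    exchange ws x y xs opt = cancel (begin
      p + (f x u + (q + (f y v + r)))
        ≡⟨ cong (λ e → p + (f x u + (e + (f y v + r)))) (sym (links-flip y xs u)) ⟩
      p + (f x u + (links f (u ∷ reverse xs ++ y ∷ []) + (f y v + r)))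
        ≡⟨ sym (links-infix ws x u (reverse xs) y v zs) ⟩
      links f (ws ++ x ∷ u ∷ reverse xs ++ y ∷ v ∷ zs)
        ≤⟨ opt _ (++⁺ˡ ws (prep x (flip-↭ y xs u (v ∷ zs)))) ⟩
      links f (ws ++ x ∷ y ∷ xs ++ u ∷ v ∷ zs)
        ≡⟨ links-infix ws x y xs u v zs ⟩
      p + (f x y + (q + (f u v + r)))
        ≡⟨ cong (λ e → p + (f x y + (q + (e + r)))) u≁v ⟩
      p + (f x y + (q + r)) ∎)
      where
      open ≤-Reasoning
      p q r : ℕ
      p = links f (ws ++ x ∷ [])
      q = links f (y ∷ xs ++ u ∷ [])
      r = links f (v ∷ zs)
      lhs-eq : ∀ a b p q r → p + (a + (q + (b + r))) ≡ (a + b) + (p + q + r)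
      lhs-eq = solve-∀
      rhs-eq : ∀ a p q r → p + (a + (q + r)) ≡ a + (p + q + r)
      rhs-eq = solve-∀
      cancel : p + (f x u + (q + (f y v + r))) ≤ p + (f x y + (q + r)) → f u x + f v y ≤ f x y
      cancel le = subst₂ (λ a b → a + b ≤ f x y) (f-sym x u) (f-sym y v)
        (+-cancelʳ-≤ (p + q + r) _ _
          (subst₂ _≤_ (lhs-eq (f x u) (f y v) p q r) (rhs-eq (f x y) p q r) le))

    -- Reversing the whole initial segment up to `u` gives up only the pair uv, which is no link,
    -- and creates the pair xv; optimality forces the latter to be no link either.
    exchange-head : ∀ x xs → Optimal (x ∷ xs ++ u ∷ v ∷ zs) → f v x ≡ 0
    exchange-head x xs opt = n≤0⇒n≡0 (subst (_≤ 0) (f-sym x v) (+-cancelʳ-≤ r _ 0 (+-cancelˡ-≤ q _ _ (begin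
      q + (f x v + r)
        ≡⟨ cong (_+ (f x v + r)) (sym (links-flip x xs u)) ⟩
      links f (u ∷ reverse xs ++ x ∷ []) + (f x v + r)
        ≡⟨ sym (links-segment u (reverse xs) x v zs) ⟩
      links f (u ∷ reverse xs ++ x ∷ v ∷ zs)
        ≤⟨ opt _ (flip-↭ x xs u (v ∷ zs)) ⟩
      links f (x ∷ xs ++ u ∷ v ∷ zs)
        ≡⟨ links-segment x xs u v zs ⟩
      q + (f u v + r)
        ≡⟨ cong (λ e → q + (e + r)) u≁v ⟩
      q + (0 + r) ∎))))
      where
      open ≤-Reasoning
      q r : ℕ
      q = links f (x ∷ xs ++ u ∷ [])
      r = links f (v ∷ zs)

    -- `exchange` is summed along the segment: the link from an entry to its successor pays for `u`
    -- at the entry and `v` at the successor, and the link into `u` pays for `u` at the last entry.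
    -- Only `v` at the first entry stays unpaid, whence the error term `f v x`. The prefix `ws` lets
    -- the induction advance the start of the segment inside a fixed ordering.
    segment-bound : ∀ ws x xs → Optimal (ws ++ x ∷ xs ++ u ∷ v ∷ zs) →
      ∑ (λ z → f u z + f v z) (x ∷ xs) ≤ links f (x ∷ xs ++ u ∷ []) + f v x
    segment-bound ws x [] opt = ≤-reflexive (begin
      f u x + f v x + 0 ≡⟨ +-identityʳ _ ⟩
      f u x + f v x     ≡⟨ cong (_+ f v x) (trans (f-sym u x) (sym (+-identityʳ _))) ⟩
      f x u + 0 + f v x ∎)
      where open ≡-Reasoning
    segment-bound ws x (y ∷ xs) opt = begin
      f u x + f v x + ∑ _ (y ∷ xs)
        ≤⟨ +-monoʳ-≤ (f u x + f v x) (segment-bound (ws ++ x ∷ []) y xs opt′) ⟩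
      f u x + f v x + (q + f v y)
        ≡⟨ shuffle (f u x) (f v x) q (f v y) ⟩
      f u x + f v y + (q + f v x)
        ≤⟨ +-monoˡ-≤ (q + f v x) (exchange ws x y xs opt) ⟩
      f x y + (q + f v x)
        ≡⟨ sym (+-assoc (f x y) q _) ⟩
      f x y + q + f v x ∎
      where
      open ≤-Reasoning
      q : ℕ
      q = links f (y ∷ xs ++ u ∷ [])
      shuffle : ∀ a b c d → a + b + (c + d) ≡ a + d + (c + b)
      shuffle = solve-∀
      opt′ : Optimal ((ws ++ x ∷ []) ++ y ∷ xs ++ u ∷ v ∷ zs)
      opt′ = subst Optimal (sym (++-assoc ws (x ∷ []) _)) opt

    -- When the segment starts the ordering, `exchange-head` removes the error term.
    half-bound : ∀ xs → Optimal (xs ++ u ∷ v ∷ zs) →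
      ∑ (λ z → f u z + f v z) xs ≤ links f (xs ++ u ∷ [])
    half-bound []       opt = z≤n
    half-bound (x ∷ xs) opt =
      ≤-trans (segment-bound [] x xs opt)
        (≤-reflexive (trans (cong (links f (x ∷ xs ++ u ∷ []) +_) (exchange-head x xs opt)) (+-identityʳ _)))

  reverse-two : ∀ xs (u v : A) zs → reverse (xs ++ u ∷ v ∷ zs) ≡ reverse zs ++ v ∷ u ∷ reverse xs
  reverse-two xs u v zs = begin
    reverse (xs ++ u ∷ v ∷ zs)                   ≡⟨ reverse-++ xs (u ∷ v ∷ zs) ⟩
    reverse (u ∷ v ∷ zs) ++ reverse xs           ≡⟨ cong (_++ reverse xs) (reverse-++ (u ∷ v ∷ []) zs) ⟩
    (reverse zs ++ v ∷ u ∷ []) ++ reverse xs     ≡⟨ ++-assoc (reverse zs) _ _ ⟩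
    reverse zs ++ v ∷ u ∷ reverse xs             ∎
    where open ≡-Reasoning

  -- The entries before `u` are handled by `half-bound`, and those after `v` by `half-bound` in the
  -- reversed ordering, where `u` and `v` trade places. The entries `u` and `v` contribute nothing
  -- to the degrees, and the two halves contain all links because uv is none.
  degree-sum-bound : ∀ {u v} → f u v ≡ 0 → ∀ xs zs → Optimal (xs ++ u ∷ v ∷ zs) →
    ∑ (f u) (xs ++ u ∷ v ∷ zs) + ∑ (f v) (xs ++ u ∷ v ∷ zs) ≤ links f (xs ++ u ∷ v ∷ zs)
  degree-sum-bound {u} {v} u≁v xs zs opt = begin
    ∑ (f u) L + ∑ (f v) L
      ≡⟨ sym (∑-+ (f u) (f v) L) ⟩
    ∑ g L
      ≡⟨ ∑-++ g xs (u ∷ v ∷ zs) ⟩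
    ∑ g xs + (f u u + f v u + (f u v + f v v + ∑ g zs))
      ≡⟨ cong (∑ g xs +_) (cong₂ _+_ (cong₂ _+_ (f-irrefl u) v≁u) (cong (_+ ∑ g zs) (cong₂ _+_ u≁v (f-irrefl v)))) ⟩
    ∑ g xs + ∑ g zs
      ≡⟨ cong (∑ g xs +_) (trans (∑-cong (λ z → +-comm (f u z) (f v z)) zs) (sym (∑-↭ _ (↭-reverse zs)))) ⟩
    ∑ g xs + ∑ (λ z → f v z + f u z) (reverse zs)
      ≤⟨ +-mono-≤ (half-bound u≁v zs xs opt)
           (half-bound v≁u (reverse xs) (reverse zs) (subst Optimal (reverse-two xs u v zs) (Optimal-reverse opt))) ⟩
    links f (xs ++ u ∷ []) + links f (reverse zs ++ v ∷ [])
      ≡⟨ cong (links f (xs ++ u ∷ []) +_) (trans (cong (links f) (sym (unfold-reverse v zs))) (links-reverse (v ∷ zs))) ⟩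
    links f (xs ++ u ∷ []) + links f (v ∷ zs)
      ≡⟨ cong (λ e → links f (xs ++ u ∷ []) + (e + links f (v ∷ zs))) (sym u≁v) ⟩
    links f (xs ++ u ∷ []) + (f u v + links f (v ∷ zs))
      ≡⟨ sym (links-split f xs u (v ∷ zs)) ⟩
    links f L ∎
    where
    open ≤-Reasoning
    L : List A
    L = xs ++ u ∷ v ∷ zs
    g : A → ℕ
    g z = f u z + f v z
    v≁u : f v u ≡ 0
    v≁u = trans (f-sym v u) u≁v

-- Adding an edge between non-adjacent vertices of large degree sum

edge : SimpleGraph n → Fin n → Fin n → ℕ
edge G u v = 𝟙 (adj G u v)

deg : SimpleGraph n → Fin n → ℕ
deg G v = ∑ (edge G v) (allFin _)

-- An ordering of the vertices is read as the spanning linear forest formed by its consecutive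
-- adjacent pairs; every linear forest arises inside one of these.
NoLinks : ℕ → SimpleGraph n → Set
NoLinks {n} k G = ∀ L → L ↭ allFin n → links (edge G) L < k

_⊑_ : SimpleGraph n → SimpleGraph n → Set
G ⊑ H = ∀ u v → adj G u v ≡ true → adj H u v ≡ true

Closed : ℕ → SimpleGraph n → Set
Closed k G = ∀ u v → u ≢ v → adj G u v ≡ false → deg G u + deg G v < k

unique-↭ : {xs ys : List A} → xs ↭ ys → Unique ys → Unique xs
unique-↭ {A} p = Permutation.Unique-resp-↭ (setoid A) (↭⇒↭ₛ (↭-sym p))

unique-middle : (xs : List A) {y : A} {ys : List A} → Unique (xs ++ y ∷ ys) → y ∉ xs ++ ys
unique-middle xs {y} {ys} u y∈ with unique-↭ (↭-sym (shift y xs ys)) u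
... | y∉ ∷ _ = All.lookup y∉ y∈ refl

-- The ordering is cut at each non-adjacent pair and, once `k` edges have been collected, at every
-- remaining pair, so that the number of edges is exactly `k`. The first path is kept in the form
-- `x ∷ p` so that a preceding neighbour of `x` can be prepended.
cut : (G : SimpleGraph n) → ∀ x xs k → k ≤ links (edge G) (x ∷ xs) →
      ∃₂ λ p ps → AllWalks G ((x ∷ p) ∷ ps) × concat ((x ∷ p) ∷ ps) ≡ x ∷ xs ×
                  sum (map pathEdges ((x ∷ p) ∷ ps)) ≡ k
cut G x []       zero    k≤ = [] , [] , (tt , tt) , refl , refl
cut G x (y ∷ ys) zero    k≤ with cut G y ys zero z≤n
... | p , ps , walks , eq , len = [] , (y ∷ p) ∷ ps , (tt , walks) , cong (x ∷_) eq , len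
cut G x (y ∷ ys) (suc k) k≤ with adj G x y in x~y
... | true with cut G y ys k (s≤s⁻¹ k≤)
...   | p , ps , (walk , walks) , eq , len =
        y ∷ p , ps , ((x~y , walk) , walks) , cong (x ∷_) eq , cong suc len
cut G x (y ∷ ys) (suc k) k≤ | false with cut G y ys (suc k) k≤
...   | p , ps , walks , eq , len = [] , (y ∷ p) ∷ ps , (tt , walks) , cong (x ∷_) eq , len

LFree⇒NoLinks : ∀ {k} (G : SimpleGraph n) → 1 ≤ k → LFree k G → NoLinks k G
LFree⇒NoLinks {k = k} G 1≤k free L p with k ≤? links (edge G) L
... | no  k≰ = ≰⇒> k≰
-- The empty ordering has no links, against `k` ≥ 1; `cut` needs a first vertex.
LFree⇒NoLinks G 1≤k free []      p | yes k≤ = contradiction (≤-trans 1≤k k≤) λ ()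
LFree⇒NoLinks G 1≤k free (x ∷ L) p | yes k≤ with cut G x L _ k≤
... | q , qs , walks , eq , len =
  contradiction ((x ∷ q) ∷ qs , walks , subst Unique (sym eq) (unique-↭ p (allFin⁺ _)) , len) free

≟-refl : (x : Fin n) → ⌊ x ≟ x ⌋ ≡ true
≟-refl x with x ≟ x
... | yes _  = refl
... | no x≢x = contradiction refl x≢x

module _ (G : SimpleGraph n) {u v : Fin n} (u≢v : u ≢ v) where

  private
    joins : Fin n → Fin n → Bool
    joins x y = (⌊ x ≟ u ⌋ ∧ ⌊ y ≟ v ⌋) ∨ (⌊ x ≟ v ⌋ ∧ ⌊ y ≟ u ⌋)

    joins-true : ∀ x y → joins x y ≡ true → (x ≡ u × y ≡ v) ⊎ (x ≡ v × y ≡ u)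
    joins-true x y eq with x ≟ u | y ≟ v | x ≟ v | y ≟ u
    ... | yes p | yes q | _     | _     = inj₁ (p , q)
    ... | yes p | no _  | yes q | yes r = inj₂ (q , r)
    ... | no _  | yes p | yes q | yes r = inj₂ (q , r)
    ... | no _  | no _  | yes q | yes r = inj₂ (q , r)
    joins-true x y () | yes _ | no _  | yes _ | no _
    joins-true x y () | yes _ | no _  | no _  | _
    joins-true x y () | no _  | _     | yes _ | no _
    joins-true x y () | no _  | _     | no _  | _

    joins-sym : ∀ x y → joins x y ≡ joins y x
    joins-sym x y = trans (Bool.∨-comm (⌊ x ≟ u ⌋ ∧ ⌊ y ≟ v ⌋) _)
      (cong₂ _∨_ (Bool.∧-comm ⌊ x ≟ v ⌋ _) (Bool.∧-comm ⌊ x ≟ u ⌋ _))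

    joins-irrefl : ∀ x → joins x x ≡ false
    joins-irrefl x with joins x x in eq
    ... | false = refl
    ... | true with joins-true x x eq
    ...   | inj₁ (p , q) = contradiction (trans (sym p) q) u≢v
    ...   | inj₂ (p , q) = contradiction (trans (sym q) p) u≢v

  addEdge : SimpleGraph n
  addEdge .adj x y  = adj G x y ∨ joins x y
  addEdge .SimpleGraph.sym x y = cong₂ _∨_ (SimpleGraph.sym G x y) (joins-sym x y)
  addEdge .irrefl x = cong₂ _∨_ (irrefl G x) (joins-irrefl x)

  addEdge-⊑ : G ⊑ addEdge
  addEdge-⊑ x y x~y = cong (_∨ joins x y) x~y

  addEdge-joins : adj addEdge u v ≡ true
  addEdge-joins rewrite ≟-refl u | ≟-refl v = Bool.∨-zeroʳ (adj G u v)

  addEdge-new : ∀ x y → edge addEdge x y ≡ edge G x y ⊎ (x ≡ u × y ≡ v) ⊎ (x ≡ v × y ≡ u)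
  addEdge-new x y with joins x y in eq
  ... | true  = inj₂ (joins-true x y eq)
  ... | false = inj₁ (cong 𝟙 (Bool.∨-identityʳ (adj G x y)))

  -- A gained link can only be the new pair, so an ordering that profits from the new edge has `u`
  -- and `v` consecutive, the situation that `degree-sum-bound` treats.
  links-addEdge : ∀ xs → links (edge addEdge) xs ≡ links (edge G) xs
                  ⊎ (∃₂ λ ys zs → xs ≡ ys ++ u ∷ v ∷ zs)
                  ⊎ (∃₂ λ ys zs → xs ≡ ys ++ v ∷ u ∷ zs)
  links-addEdge []       = inj₁ refl
  links-addEdge (x ∷ []) = inj₁ refl
  links-addEdge (x ∷ y ∷ xs) with addEdge-new x y | links-addEdge (y ∷ xs)
  ... | inj₂ (inj₁ (refl , refl)) | _ = inj₂ (inj₁ ([] , xs , refl))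
  ... | inj₂ (inj₂ (refl , refl)) | _ = inj₂ (inj₂ ([] , xs , refl))
  ... | inj₁ eq | inj₁ eq′ = inj₁ (cong₂ _+_ eq eq′)
  ... | inj₁ eq | inj₂ (inj₁ (ys , zs , eq′)) = inj₂ (inj₁ (x ∷ ys , zs , cong (x ∷_) eq′))
  ... | inj₁ eq | inj₂ (inj₂ (ys , zs , eq′)) = inj₂ (inj₂ (x ∷ ys , zs , cong (x ∷_) eq′))

  -- A new link would need both `u` and `v` among the entries.
  links-addEdge-∉ : ∀ {z} → z ≡ u ⊎ z ≡ v → ∀ xs → z ∉ xs →
                    links (edge addEdge) xs ≡ links (edge G) xs
  links-addEdge-∉ z≡ []           z∉ = refl
  links-addEdge-∉ z≡ (x ∷ [])     z∉ = refl
  links-addEdge-∉ z≡ (x ∷ y ∷ xs) z∉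
    with z≡ | addEdge-new x y | links-addEdge-∉ z≡ (y ∷ xs) (z∉ ∘ there)
  ... | _         | inj₁ eq                   | eq′ = cong₂ _+_ eq eq′
  ... | inj₁ refl | inj₂ (inj₁ (refl , refl)) | _   = contradiction (here refl) z∉
  ... | inj₁ refl | inj₂ (inj₂ (refl , refl)) | _   = contradiction (there (here refl)) z∉
  ... | inj₂ refl | inj₂ (inj₁ (refl , refl)) | _   = contradiction (there (here refl)) z∉
  ... | inj₂ refl | inj₂ (inj₂ (refl , refl)) | _   = contradiction (here refl) z∉

  -- By uniqueness the part ending in `u` misses `v` and the part starting with `v` misses `u`;
  -- neither gains a link, so only the pair uv can.
  links-addEdge-≤ : ∀ xs zs → Unique (xs ++ u ∷ v ∷ zs) →
    links (edge addEdge) (xs ++ u ∷ v ∷ zs) ≤ suc (links (edge G) (xs ++ u ∷ v ∷ zs))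
  links-addEdge-≤ xs zs uniq = begin
    links (edge addEdge) (xs ++ u ∷ v ∷ zs)
      ≡⟨ links-split (edge addEdge) xs u (v ∷ zs) ⟩
    links (edge addEdge) (xs ++ u ∷ []) + (edge addEdge u v + links (edge addEdge) (v ∷ zs))
      ≡⟨ cong₂ (λ a b → a + (edge addEdge u v + b))
           (links-addEdge-∉ (inj₂ refl) (xs ++ u ∷ []) v∉)
           (links-addEdge-∉ (inj₁ refl) (v ∷ zs) (unique-middle xs uniq ∘ ∈-++⁺ʳ xs)) ⟩
    p + (edge addEdge u v + q)
      ≤⟨ +-monoʳ-≤ p (+-monoˡ-≤ q (≤-trans (𝟙≤1 _) (m≤m+n 1 (edge G u v)))) ⟩
    p + suc (edge G u v + q)
      ≡⟨ +-suc p _ ⟩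
    suc (p + (edge G u v + q))
      ≡⟨ cong suc (sym (links-split (edge G) xs u (v ∷ zs))) ⟩
    suc (links (edge G) (xs ++ u ∷ v ∷ zs)) ∎
    where
    open ≤-Reasoning
    p q : ℕ
    p = links (edge G) (xs ++ u ∷ [])
    q = links (edge G) (v ∷ zs)
    v∉ : v ∉ xs ++ u ∷ []
    v∉ = unique-middle (xs ++ u ∷ []) (subst Unique (sym (++-assoc xs _ _)) uniq) ∘ ∈-++⁺ˡ

  module _ {k : ℕ} (u≁v : adj G u v ≡ false) (k≤deg : k ≤ deg G u + deg G v)
           (none : NoLinks k G) where

    private
      open module R (H : SimpleGraph n) =
        Rotation (edge H) (λ x y → cong 𝟙 (SimpleGraph.sym H x y)) (λ x → cong 𝟙 (irrefl H x))

    -- An ordering with at least `k` links after the addition has at least `k` - 1 before it, and no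
    -- ordering had more, so it was optimal in `G`. Then `degree-sum-bound` yields `k` ≤ deg u + deg
    -- v ≤ its number of links in `G`, contradicting `none`.
    addEdge-links-through : ∀ xs zs → xs ++ u ∷ v ∷ zs ↭ allFin n →
      ¬ (k ≤ links (edge addEdge) (xs ++ u ∷ v ∷ zs))
    addEdge-links-through xs zs p k≤ = <⇒≱ (none L p) (begin
      k                                    ≤⟨ k≤deg ⟩
      deg G u + deg G v                    ≡⟨ sym (cong₂ _+_ (∑-↭ _ p) (∑-↭ _ p)) ⟩
      ∑ (edge G u) L + ∑ (edge G v) L      ≤⟨ degree-sum-bound G (cong 𝟙 u≁v) xs zs optimal ⟩
      links (edge G) L                     ∎)
      where
      open ≤-Reasoning
      L : List (Fin n)
      L = xs ++ u ∷ v ∷ zs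
      optimal : Optimal G L
      optimal L′ q = s≤s⁻¹ (≤-trans (none L′ (↭-trans q p))
        (≤-trans k≤ (links-addEdge-≤ xs zs (unique-↭ p (allFin⁺ n)))))

    addEdge-NoLinks : NoLinks k addEdge
    addEdge-NoLinks L p with k ≤? links (edge addEdge) L
    ... | no  k≰ = ≰⇒> k≰
    ... | yes k≤ with links-addEdge L
    ...   | inj₁ eq = contradiction (none L p) (≤⇒≯ (subst (k ≤_) eq k≤))
    ...   | inj₂ (inj₁ (xs , zs , refl)) = contradiction k≤ (addEdge-links-through xs zs p)
    -- Here `v` comes just before `u`; reversing the ordering keeps its links and restores the order
    -- u, v.
    ...   | inj₂ (inj₂ (xs , zs , refl)) = contradiction
      (subst (λ M → k ≤ links (edge addEdge) M) eq
        (≤-trans k≤ (≤-reflexive (sym (links-reverse addEdge L)))))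
      (addEdge-links-through (reverse zs) (reverse xs)
        (↭-trans (↭-reflexive (sym eq)) (↭-trans (↭-reverse L) p)))
      where
      eq : reverse L ≡ reverse zs ++ u ∷ v ∷ reverse xs
      eq = reverse-two addEdge xs v u zs

-- The closure of a graph under edge additions.

-- Termination measure for `closure`; it counts ordered pairs, the diagonal included.
missing : SimpleGraph n → ℕ
missing G = ∑ (λ u → ∑ (λ v → 𝟙 (not (adj G u v))) (allFin _)) (allFin _)

missing-< : (G H : SimpleGraph n) → G ⊑ H → ∀ {u v} → adj G u v ≡ false → adj H u v ≡ true →
            missing H < missing G
missing-< G H G⊑H {u} {v} u≁v u~v =
  ∑-mono-< (λ x → ∑-mono (fewer x) (allFin _)) (∈-allFin u)
    (∑-mono-< (fewer u) (∈-allFin v) (≤-reflexive (trans (cong (suc ∘ 𝟙 ∘ not) u~v) (sym (cong (𝟙 ∘ not) u≁v)))))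
  where
  fewer : ∀ x y → 𝟙 (not (adj H x y)) ≤ 𝟙 (not (adj G x y))
  fewer x y with adj G x y in eq
  ... | false = 𝟙≤1 _
  ... | true rewrite G⊑H x y eq = z≤n

closure : ∀ {k} fuel (G : SimpleGraph n) → missing G ≤ fuel → NoLinks k G →
          ∃ λ H → G ⊑ H × NoLinks k H × Closed k H
closure {k = k} fuel G m≤ none with any? (λ u → any? (λ v →
  ¬? (u ≟ v) ×-dec (adj G u v Bool.≟ false) ×-dec (k ≤? deg G u + deg G v)))
... | no ¬p = G , (λ _ _ u~v → u~v) , none , λ u v u≢v u≁v → ≰⇒> λ k≤ → ¬p (u , v , u≢v , u≁v , k≤)
-- The measure drops strictly when uv is added, so the fuel is a successor and cannot run out early.
closure fuel G m≤ none | yes (u , v , u≢v , u≁v , k≤)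
  with ≤-trans (missing-< G (addEdge G u≢v) (addEdge-⊑ G u≢v) u≁v (addEdge-joins G u≢v)) m≤
closure (suc fuel) G m≤ none | yes (u , v , u≢v , u≁v , k≤) | s≤s m′≤
  with closure fuel (addEdge G u≢v) m′≤ (addEdge-NoLinks G u≢v u≁v k≤ none)
... | H , ⊑H , none′ , closed = H , (λ x y → ⊑H x y ∘ addEdge-⊑ G u≢v x y) , none′ , closed

-- Counting cliques

⌊⌋-sound : {P : Set} (P? : Dec P) → ⌊ P? ⌋ ≡ true → P
⌊⌋-sound (yes p) _ = p

⌊⌋-complete : {P : Set} (P? : Dec P) → P → ⌊ P? ⌋ ≡ true
⌊⌋-complete (yes _) p = refl
⌊⌋-complete (no ¬p) p = contradiction p ¬p

⌊⌋-false : {P : Set} (P? : Dec P) → ¬ P → ⌊ P? ⌋ ≡ false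
⌊⌋-false (yes p) ¬p = contradiction p ¬p
⌊⌋-false (no _)  ¬p = refl

∧-true : ∀ {a b} → a ∧ b ≡ true → a ≡ true × b ≡ true
∧-true {true} {true} _ = refl , refl

all-lookup : (p : A → Bool) → ∀ {xs x} → all p xs ≡ true → x ∈ xs → p x ≡ true
all-lookup p all≡ (here refl) = proj₁ (∧-true all≡)
all-lookup p {y ∷ xs} all≡ (there x∈) = all-lookup p (proj₂ (∧-true {p y} all≡)) x∈

all-true : (p : A → Bool) → (∀ x → p x ≡ true) → ∀ xs → all p xs ≡ true
all-true p p≡ []       = refl
all-true p p≡ (x ∷ xs) = cong₂ _∧_ (p≡ x) (all-true p p≡ xs)

Clique : SimpleGraph n → Vec Bool n → Set
Clique G S = ∀ u v → lookup S u ≡ true → lookup S v ≡ true → u ≢ v → adj G u v ≡ true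

isClique-sound : (G : SimpleGraph n) (S : Vec Bool n) → isClique G S ≡ true → Clique G S
isClique-sound G S clique u v u∈ v∈ u≢v =
  drop (all-lookup _ (all-lookup _ clique (∈-allFin u)) (∈-allFin v))
  where
  drop : not (lookup S u ∧ lookup S v ∧ not ⌊ u ≟ v ⌋) ∨ adj G u v ≡ true → adj G u v ≡ true
  drop rewrite u∈ | v∈ | ⌊⌋-false (u ≟ v) u≢v = λ eq → eq

isClique-complete : (G : SimpleGraph n) (S : Vec Bool n) → Clique G S → isClique G S ≡ true
isClique-complete G S clique = all-true _ (λ u → all-true _ (pair u) (allFin _)) (allFin _)
  where
  pair : ∀ u v → not (lookup S u ∧ lookup S v ∧ not ⌊ u ≟ v ⌋) ∨ adj G u v ≡ true
  pair u v with lookup S u in u∈ | lookup S v in v∈ | u ≟ v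
  ... | false | _     | _      = refl
  ... | true  | false | _      = refl
  ... | true  | true  | yes _  = refl
  ... | true  | true  | no u≢v = clique u v u∈ v∈ u≢v

isKsCopy-sound : ∀ s (G : SimpleGraph n) S → isKsCopy s G S ≡ true → size S ≡ s × Clique G S
isKsCopy-sound s G S copy with ∧-true copy
... | size≡ , clique = ⌊⌋-sound (size S ℕ.≟ s) size≡ , isClique-sound G S clique

isKsCopy-complete : ∀ s (G : SimpleGraph n) S → size S ≡ s → Clique G S → isKsCopy s G S ≡ true
isKsCopy-complete s G S size≡ clique =
  cong₂ _∧_ (⌊⌋-complete (size S ℕ.≟ s) size≡) (isClique-complete G S clique)

length-filter-∑ : (p : A → Bool) → ∀ xs → length (filter (λ x → p x Bool.≟ true) xs) ≡ ∑ (𝟙 ∘ p) xs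
length-filter-∑ p []       = refl
length-filter-∑ p (x ∷ xs) with p x
... | true  = cong suc (length-filter-∑ p xs)
... | false = length-filter-∑ p xs

numKs-∑ : ∀ s (G : SimpleGraph n) → numKs s G ≡ ∑ (𝟙 ∘ isKsCopy s G) (allSubsets n)
numKs-∑ s G = length-filter-∑ (isKsCopy s G) (allSubsets _)

numKs-mono : ∀ s {G H : SimpleGraph n} → G ⊑ H → numKs s G ≤ numKs s H
numKs-mono s {G} {H} G⊑H = subst₂ _≤_ (sym (numKs-∑ s G)) (sym (numKs-∑ s H))
  (∑-mono (λ S → 𝟙-mono (copy S)) (allSubsets _))
  where
  copy : ∀ S → isKsCopy s G S ≡ true → isKsCopy s H S ≡ true
  copy S c with isKsCopy-sound s G S c
  ... | size≡ , clique =
    isKsCopy-complete s H S size≡ (λ u v u∈ v∈ u≢v → G⊑H u v (clique u v u∈ v∈ u≢v))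

-- Counting subsets of a given size.

-- Recursion on the vectors follows the recursion of `allSubsets`, so the count of subsets unfolds
-- one vertex at a time.
within : Vec Bool n → Vec Bool n → Bool
within []          []      = true
within (true  ∷ S) (b ∷ T) = b ∧ within S T
within (false ∷ S) (_ ∷ T) = within S T

_⊆_ : Vec Bool n → Vec Bool n → Set
S ⊆ T = ∀ x → lookup S x ≡ true → lookup T x ≡ true

within-sound : (S T : Vec Bool n) → within S T ≡ true → S ⊆ T
within-sound (true  ∷ S) (b ∷ T) eq zero    x∈ = proj₁ (∧-true eq)
within-sound (true  ∷ S) (b ∷ T) eq (suc x) x∈ = within-sound S T (proj₂ (∧-true {b} eq)) x x∈
within-sound (false ∷ S) (_ ∷ T) eq (suc x) x∈ = within-sound S T eq x x∈

within-complete : (S T : Vec Bool n) → S ⊆ T → within S T ≡ true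
within-complete []          []      S⊆T = refl
within-complete (true  ∷ S) (b ∷ T) S⊆T = cong₂ _∧_ (S⊆T zero refl) (within-complete S T (S⊆T ∘ suc))
within-complete (false ∷ S) (_ ∷ T) S⊆T = within-complete S T (S⊆T ∘ suc)

isSubset : ℕ → Vec Bool n → Vec Bool n → Bool
isSubset s T S = ⌊ size S ℕ.≟ s ⌋ ∧ within S T

isSubset-sound : ∀ s (T S : Vec Bool n) → isSubset s T S ≡ true → size S ≡ s × S ⊆ T
isSubset-sound s T S eq with ∧-true eq
... | size≡ , within≡ = ⌊⌋-sound (size S ℕ.≟ s) size≡ , within-sound S T within≡

isSubset-complete : ∀ s (T S : Vec Bool n) → size S ≡ s → S ⊆ T → isSubset s T S ≡ true
isSubset-complete s T S size≡ S⊆T =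
  cong₂ _∧_ (⌊⌋-complete (size S ℕ.≟ s) size≡) (within-complete S T S⊆T)

∑-allSubsets : (f : Vec Bool (suc n) → ℕ) →
  ∑ f (allSubsets (suc n)) ≡ ∑ (f ∘ (true ∷_)) (allSubsets n) + ∑ (f ∘ (false ∷_)) (allSubsets n)
∑-allSubsets {n} f = trans (∑-++ f (map (true ∷_) (allSubsets n)) _)
  (cong₂ _+_ (∑-map f (true ∷_) (allSubsets n)) (∑-map f (false ∷_) (allSubsets n)))

⌊suc≟suc⌋ : ∀ a b → ⌊ suc a ℕ.≟ suc b ⌋ ≡ ⌊ a ℕ.≟ b ⌋
⌊suc≟suc⌋ a b = trans (isYes≗does (suc a ℕ.≟ suc b)) (sym (isYes≗does (a ℕ.≟ b)))

-- Splitting on whether the first vertex is chosen gives Pascal's rule when that vertex lies in `T`;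
-- when it does not, the choice contributes nothing.
count-subsets : (T : Vec Bool n) → ∀ s → ∑ (𝟙 ∘ isSubset s T) (allSubsets n) ≡ size T C s
count-subsets []          zero    = refl
count-subsets []          (suc s) = refl
count-subsets {suc n} (true  ∷ T) zero    =
  trans (∑-allSubsets (𝟙 ∘ isSubset 0 (true ∷ T)))
    (cong₂ _+_ (∑-zero (allSubsets n)) (count-subsets T zero))
count-subsets {suc n} (true  ∷ T) (suc s) =
  trans (∑-allSubsets (𝟙 ∘ isSubset (suc s) (true ∷ T)))
    (trans (cong₂ _+_
        (trans (∑-cong (λ S → cong (λ b → 𝟙 (b ∧ within S T)) (⌊suc≟suc⌋ (size S) s)) (allSubsets n)) (count-subsets T s))
        (count-subsets T (suc s)))
      (nCk+nC[k+1]≡[n+1]C[k+1] (size T) s))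
count-subsets {suc n} (false ∷ T) s       =
  trans (∑-allSubsets (𝟙 ∘ isSubset s (false ∷ T)))
    (cong₂ _+_
      (trans (∑-cong (λ S → cong 𝟙 (Bool.∧-zeroʳ ⌊ size (true ∷ S) ℕ.≟ s ⌋)) (allSubsets n)) (∑-zero (allSubsets n)))
      (count-subsets T s))

size-insert : (T : Vec Bool n) (w : Fin n) → lookup T w ≡ false → size (T [ w ]≔ true) ≡ suc (size T)
size-insert (false ∷ T) zero    _  = refl
size-insert (true  ∷ T) (suc w) w∉ = cong suc (size-insert T w w∉)
size-insert (false ∷ T) (suc w) w∉ = size-insert T w w∉

lookup-insert : (T : Vec Bool n) (w x : Fin n) → lookup T x ≡ true → lookup (T [ w ]≔ true) x ≡ true
lookup-insert T w x x∈ with x ≟ w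
... | yes refl = lookup∘updateAt x T
... | no x≢w   = trans (lookup∘updateAt′ x w x≢w T) x∈

-- A subset of T ∪ {w} containing w is a subset of T ∪ {w} that is not a subset of T,
-- so Pascal's rule gives the count.
count-subsets-through : (T : Vec Bool n) (w : Fin n) → lookup T w ≡ false → ∀ s →
  ∑ (λ S → 𝟙 (isSubset (suc s) (T [ w ]≔ true) S ∧ lookup S w)) (allSubsets n) ≤ size T C s
count-subsets-through {n} T w w∉ s = +-cancelˡ-≤ (size T C suc s) _ _ (begin
  size T C suc s + ∑ g (allSubsets n)
    ≡⟨ cong (_+ ∑ g (allSubsets n)) (sym (count-subsets T (suc s))) ⟩
  ∑ f (allSubsets n) + ∑ g (allSubsets n)
    ≡⟨ sym (∑-+ f g (allSubsets n)) ⟩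
  ∑ (λ S → f S + g S) (allSubsets n)
    ≤⟨ ∑-mono pointwise (allSubsets n) ⟩
  ∑ (𝟙 ∘ isSubset (suc s) T′) (allSubsets n)
    ≡⟨ count-subsets T′ (suc s) ⟩
  size T′ C suc s
    ≡⟨ cong (_C suc s) (size-insert T w w∉) ⟩
  suc (size T) C suc s
    ≡⟨ sym (nCk+nC[k+1]≡[n+1]C[k+1] (size T) s) ⟩
  size T C s + size T C suc s
    ≡⟨ +-comm (size T C s) _ ⟩
  size T C suc s + size T C s ∎)
  where
  open ≤-Reasoning
  T′ : Vec Bool n
  T′ = T [ w ]≔ true
  f g : Vec Bool n → ℕ
  f S = 𝟙 (isSubset (suc s) T S)
  g S = 𝟙 (isSubset (suc s) T′ S ∧ lookup S w)
  pointwise : ∀ S → f S + g S ≤ 𝟙 (isSubset (suc s) T′ S)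
  pointwise S with isSubset (suc s) T S in eq
  ... | false = 𝟙-mono (proj₁ ∘ ∧-true)
  ... | true with isSubset-sound (suc s) T S eq
  ...   | size≡ , S⊆T with lookup S w in w∈
  ...     | true  = contradiction (trans (sym (S⊆T w w∈)) w∉) λ ()
  ...     | false rewrite Bool.∧-zeroʳ (isSubset (suc s) T′ S)
                        | isSubset-complete (suc s) T′ S size≡ (λ x x∈ → lookup-insert T w x (S⊆T x x∈)) = ≤-refl

∑-allFin : (f : Fin (suc n) → ℕ) → ∑ f (allFin (suc n)) ≡ f zero + ∑ (f ∘ suc) (allFin n)
∑-allFin f = cong (λ xs → f zero + sum xs) (trans (map-tabulate suc f) (sym (map-tabulate (λ x → x) (f ∘ suc))))

size-∑ : (D : Vec Bool n) → ∑ (λ x → 𝟙 (lookup D x)) (allFin n) ≡ size D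
size-∑ []          = refl
size-∑ (true  ∷ D) = trans (∑-allFin (λ x → 𝟙 (lookup (true ∷ D) x))) (cong suc (size-∑ D))
size-∑ (false ∷ D) = trans (∑-allFin (λ x → 𝟙 (lookup (false ∷ D) x))) (size-∑ D)

size-not : (D : Vec Bool n) → size (Vec.map not D) + size D ≡ n
size-not []          = refl
size-not (true  ∷ D) = trans (+-suc _ _) (cong suc (size-not D))
size-not (false ∷ D) = cong suc (size-not D)

-- Used to cut the set of low-degree vertices down to exactly the n - k + h vertices that f(h)
-- speaks of.
shrink : (D : Vec Bool n) → ∀ m → m ≤ size D → ∃ λ D′ → size D′ ≡ m × D′ ⊆ D
shrink []          zero    _         = [] , refl , λ ()
shrink (false ∷ D) m       m≤        with shrink D m m≤
... | D′ , size≡ , D′⊆D = false ∷ D′ , size≡ , λ { (suc x) → D′⊆D x }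
shrink (true  ∷ D) zero    _         with shrink D zero z≤n
... | D′ , size≡ , D′⊆D = false ∷ D′ , size≡ , λ { (suc x) → D′⊆D x }
shrink (true  ∷ D) (suc m) (s≤s m≤)  with shrink D m m≤
... | D′ , size≡ , D′⊆D = true ∷ D′ , cong suc size≡ , λ { zero _ → refl ; (suc x) → D′⊆D x }

C-monoˡ-≤ : ∀ k {m n} → m ≤ n → m C k ≤ n C k
C-monoˡ-≤ zero    _   = ≤-refl
C-monoˡ-≤ (suc k) m≤n = go (≤⇒≤′ m≤n)
  where
  go : ∀ {m n} → m ≤′ n → m C suc k ≤ n C suc k
  go ≤′-refl                 = ≤-refl
  go {n = suc n} (≤′-step p) = ≤-trans (go p)
    (≤-trans (m≤n+m _ (n C k)) (≤-reflexive (nCk+nC[k+1]≡[n+1]C[k+1] n k)))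

-- Cliques and vertices of small degree.

neighbours : SimpleGraph n → Fin n → Vec Bool n
neighbours G v = Vec.tabulate (adj G v)

size-neighbours : (G : SimpleGraph n) (v : Fin n) → size (neighbours G v) ≡ deg G v
size-neighbours G v = trans (sym (size-∑ (neighbours G v)))
  (∑-cong (λ x → cong 𝟙 (lookup∘tabulate (adj G v) x)) (allFin _))

-- A clique through `w` consists of `w` and neighbours of `w`, so `count-subsets-through` applies to
-- the neighbourhood.
count-cliques-through : (G : SimpleGraph n) (w : Fin n) → ∀ s →
  ∑ (λ S → 𝟙 (isKsCopy (suc s) G S ∧ lookup S w)) (allSubsets n) ≤ deg G w C s
count-cliques-through {n} G w s = begin
  ∑ (λ S → 𝟙 (isKsCopy (suc s) G S ∧ lookup S w)) (allSubsets n)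
    ≤⟨ ∑-mono (λ S → 𝟙-mono (inside S)) (allSubsets n) ⟩
  ∑ (λ S → 𝟙 (isSubset (suc s) (N [ w ]≔ true) S ∧ lookup S w)) (allSubsets n)
    ≤⟨ count-subsets-through N w (trans (lookup∘tabulate (adj G w) w) (irrefl G w)) s ⟩
  size N C s
    ≡⟨ cong (_C s) (size-neighbours G w) ⟩
  deg G w C s ∎
  where
  open ≤-Reasoning
  N : Vec Bool n
  N = neighbours G w
  inside : ∀ S → isKsCopy (suc s) G S ∧ lookup S w ≡ true →
           isSubset (suc s) (N [ w ]≔ true) S ∧ lookup S w ≡ true
  inside S eq with ∧-true {isKsCopy (suc s) G S} eq
  ... | copy , w∈ with isKsCopy-sound (suc s) G S copy
  ...   | size≡ , clique = cong₂ _∧_ (isSubset-complete (suc s) _ S size≡ S⊆) w∈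
    where
    S⊆ : S ⊆ (N [ w ]≔ true)
    S⊆ x x∈ with x ≟ w
    ... | yes refl = lookup∘updateAt x N
    ... | no x≢w   = trans (lookup∘updateAt′ x w x≢w N)
      (trans (lookup∘tabulate (adj G w) x) (clique w x w∈ x∈ (x≢w ∘ sym)))

-- A clique that misses `D` is a subset of the complement; one that meets `D` is counted at each of
-- its vertices in `D`, hence at least once. Exchanging the sums leaves, for each vertex of `D`, the
-- cliques through it.
numKs-low-degree : (G : SimpleGraph n) (D : Vec Bool n) → ∀ {h} →
  (∀ w → lookup D w ≡ true → deg G w ≤ h) → ∀ s →
  numKs (suc s) G ≤ size (Vec.map not D) C suc s + size D * (h C s)
numKs-low-degree {n} G D {h} low s = begin
  numKs (suc s) G
    ≡⟨ numKs-∑ (suc s) G ⟩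
  ∑ (𝟙 ∘ isKsCopy (suc s) G) (allSubsets n)
    ≤⟨ ∑-mono pointwise (allSubsets n) ⟩
  ∑ (λ S → 𝟙 (isSubset (suc s) (Vec.map not D) S) + ∑ (through S) (allFin n)) (allSubsets n)
    ≡⟨ ∑-+ _ _ (allSubsets n) ⟩
  ∑ (𝟙 ∘ isSubset (suc s) (Vec.map not D)) (allSubsets n) + ∑ (λ S → ∑ (through S) (allFin n)) (allSubsets n)
    ≡⟨ cong₂ _+_ (count-subsets (Vec.map not D) (suc s)) (∑-swap through (allSubsets n) (allFin n)) ⟩
  size (Vec.map not D) C suc s + ∑ (λ w → ∑ (λ S → through S w) (allSubsets n)) (allFin n)
    ≤⟨ +-monoʳ-≤ (size (Vec.map not D) C suc s) (∑-mono through-bound (allFin n)) ⟩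
  size (Vec.map not D) C suc s + ∑ (λ w → 𝟙 (lookup D w) * (h C s)) (allFin n)
    ≡⟨ cong (size (Vec.map not D) C suc s +_) (trans (∑-*ʳ _ (h C s) (allFin n)) (cong (_* (h C s)) (size-∑ D))) ⟩
  size (Vec.map not D) C suc s + size D * (h C s) ∎
  where
  open ≤-Reasoning
  through : Vec Bool n → Fin n → ℕ
  through S w = 𝟙 (lookup D w ∧ (isKsCopy (suc s) G S ∧ lookup S w))
  pointwise : ∀ S → 𝟙 (isKsCopy (suc s) G S) ≤
              𝟙 (isSubset (suc s) (Vec.map not D) S) + ∑ (through S) (allFin n)
  pointwise S with isKsCopy (suc s) G S in copy
  ... | false = z≤n
  ... | true with any? (λ w → (lookup D w Bool.≟ true) ×-dec (lookup S w Bool.≟ true))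
  ...   | yes (w , w∈D , w∈S) = ≤-trans
      (≤-trans (≤-reflexive (sym (cong₂ (λ a b → 𝟙 (a ∧ b)) w∈D w∈S)))
        (∑-∈ (λ x → 𝟙 (lookup D x ∧ lookup S x)) (∈-allFin w)))
      (m≤n+m _ (𝟙 (isSubset (suc s) (Vec.map not D) S)))
  ...   | no disjoint = ≤-trans
      (≤-reflexive (sym (cong 𝟙 (isSubset-complete (suc s) (Vec.map not D) S
        (proj₁ (isKsCopy-sound (suc s) G S copy)) avoid))))
      (m≤m+n _ _)
    where
    avoid : S ⊆ Vec.map not D
    avoid x x∈ with lookup D x in eq
    ... | true  = contradiction (x , eq , x∈) disjoint
    ... | false = trans (lookup-map x not D) (cong not eq)
  through-bound : ∀ w → ∑ (λ S → through S w) (allSubsets n) ≤ 𝟙 (lookup D w) * (h C s)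
  through-bound w with lookup D w in w∈
  ... | false = ≤-reflexive (∑-zero (allSubsets n))
  ... | true  = ≤-trans (count-cliques-through G w s)
    (≤-trans (C-monoˡ-≤ s (low w w∈)) (≤-reflexive (sym (+-identityʳ _))))

-- The function f of the header, with s = suc r; n − k + h is written n ∸ (k ∸ h).
cliques : ℕ → ℕ → ℕ → ℕ → ℕ
cliques n k r h = (k ∸ h) C suc r + (n ∸ (k ∸ h)) * (h C r)

-- The non-neighbours of `v` other than `v` number n - 1 - deg v, which is at least n - k + h
-- because deg u + deg v < k. Exactly n - k + h of them serve as the set `D` of `numKs-low-degree`.
numKs-max-pair : ∀ {k} (G : SimpleGraph n) → k ≤ n → ∀ {u v} →
  deg G u + deg G v < k → (∀ w → w ≢ v → adj G v w ≡ false → deg G w ≤ deg G u) →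
  ∀ r → numKs (suc r) G ≤ cliques n k r (deg G u)
numKs-max-pair {n} {k} G k≤n {u} {v} deg< low r = begin
  numKs (suc r) G
    ≤⟨ numKs-low-degree G D′ (λ w w∈ → low-D w (D′⊆D w w∈)) r ⟩
  size (Vec.map not D′) C suc r + size D′ * (h C r)
    ≡⟨ cong₂ (λ a b → a C suc r + b * (h C r)) size-not-D′ size-D′ ⟩
  cliques n k r h ∎
  where
  open ≤-Reasoning
  h m : ℕ
  h = deg G u
  m = n ∸ (k ∸ h)
  E D : Vec Bool n
  E = Vec.map not (neighbours G v)
  -- By irreflexivity `v` is among its own non-neighbours; it is taken out because its degree may
  -- exceed `h`.
  D = E [ v ]≔ false
  lookup-E : ∀ w → lookup E w ≡ not (adj G v w)
  lookup-E w = trans (lookup-map w not (neighbours G v)) (cong not (lookup∘tabulate (adj G v) w))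
  v∈E : lookup E v ≡ true
  v∈E = trans (lookup-E v) (cong not (irrefl G v))
  E≡ : D [ v ]≔ true ≡ E
  E≡ = trans ([]≔-idempotent E v) (trans (cong (E [ v ]≔_) (sym v∈E)) ([]≔-lookup E v))
  size-D : suc (size D) + deg G v ≡ n
  size-D = trans (cong₂ _+_
      (trans (sym (size-insert D v (lookup∘updateAt v E))) (cong size E≡))
      (sym (size-neighbours G v)))
    (size-not (neighbours G v))
  m≤ : m ≤ size D
  m≤ = begin
    n ∸ (k ∸ h)
      ≤⟨ ∸-monoʳ-≤ n (m+n≤o⇒m≤o∸n (suc (deg G v)) (subst (_≤ k) (cong suc (+-comm h (deg G v))) deg<)) ⟩
    n ∸ suc (deg G v)
      ≡⟨ cong (_∸ suc (deg G v)) (trans (sym size-D) (sym (+-suc (size D) (deg G v)))) ⟩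
    size D + suc (deg G v) ∸ suc (deg G v)
      ≡⟨ m+n∸n≡m (size D) (suc (deg G v)) ⟩
    size D ∎
  low-D : ∀ w → lookup D w ≡ true → deg G w ≤ h
  low-D w w∈ with w ≟ v
  ... | yes refl = contradiction (trans (sym w∈) (lookup∘updateAt w E)) λ ()
  ... | no w≢v = low w w≢v (Bool.not-injective
    (trans (sym (lookup-E w)) (trans (sym (lookup∘updateAt′ w v w≢v E)) w∈)))
  D′ : Vec Bool n
  D′ = proj₁ (shrink D m m≤)
  size-D′ : size D′ ≡ m
  size-D′ = proj₁ (proj₂ (shrink D m m≤))
  D′⊆D : D′ ⊆ D
  D′⊆D = proj₂ (proj₂ (shrink D m m≤))
  size-not-D′ : size (Vec.map not D′) ≡ k ∸ h
  size-not-D′ = begin-equality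
    size (Vec.map not D′)                     ≡⟨ sym (m+n∸n≡m _ (size D′)) ⟩
    size (Vec.map not D′) + size D′ ∸ size D′ ≡⟨ cong₂ _∸_ (size-not D′) size-D′ ⟩
    n ∸ (n ∸ (k ∸ h))                         ≡⟨ m∸[m∸n]≡n (≤-trans (m∸n≤m k h) k≤n) ⟩
    k ∸ h                                     ∎

links-complete : (G : SimpleGraph n) → (∀ u v → u ≢ v → adj G u v ≡ true) →
  ∀ {xs} → Unique xs → length xs ≤ suc (links (edge G) xs)
links-complete G complete []       = z≤n
links-complete G complete ([] ∷ u) = ≤-refl
links-complete G complete {x ∷ y ∷ xs} ((x≢y ∷ _) ∷ u) rewrite complete x y x≢y =
  s≤s (links-complete G complete u)

-- In a complete graph every ordering is a Hamiltonian path, with n - 1 ≥ `k` links.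
exists-non-edge : ∀ {k} (G : SimpleGraph n) → k + 1 ≤ n → NoLinks k G →
  ∃₂ λ u v → u ≢ v × adj G u v ≡ false
exists-non-edge {n} {k} G k<n none
  with any? (λ u → any? (λ v → ¬? (u ≟ v) ×-dec (adj G u v Bool.≟ false)))
... | yes p = p
... | no ¬p = contradiction (none (allFin n) ↭-refl) (≤⇒≯ (s≤s⁻¹ (begin
  suc k                              ≡⟨ +-comm 1 k ⟩
  k + 1                              ≤⟨ k<n ⟩
  n                                  ≡⟨ sym (length-tabulate {n = n} (λ x → x)) ⟩
  length (allFin n)                  ≤⟨ links-complete G complete (allFin⁺ n) ⟩
  suc (links (edge G) (allFin n))    ∎)))
  where
  open ≤-Reasoning
  complete : ∀ u v → u ≢ v → adj G u v ≡ true
  complete u v u≢v = Bool.¬-not λ u≁v → ¬p (u , v , u≢v , u≁v)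

-- The non-edge of largest degree sum is oriented so that its first end has the smaller degree `h`.
-- Comparing it with the non-edges at the other end bounds the degrees there by `h`, and closedness
-- gives 2h < `k`.
closed-bound : ∀ {k} (G : SimpleGraph n) → k + 1 ≤ n → NoLinks k G → Closed k G →
  ∃ λ h → h + h < k × (∀ r → numKs (suc r) G ≤ cliques n k r h)
closed-bound {n} {k} G k<n none closed = go (≤-total (deg G (proj₁ top)) (deg G (proj₂ top)))
  where
  NonEdge : Fin n × Fin n → Set
  NonEdge (u , v) = u ≢ v × adj G u v ≡ false
  NonEdge? : ∀ p → Dec (NonEdge p)
  NonEdge? (u , v) = ¬? (u ≟ v) ×-dec (adj G u v Bool.≟ false)
  degSum : Fin n × Fin n → ℕ
  degSum (u , v) = deg G u + deg G v
  start top : Fin n × Fin n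
  pairs : List (Fin n × Fin n)
  -- The default value of `argmax` is itself a non-edge, so the maximiser is one in every case.
  start = proj₁ (exists-non-edge G k<n none) , proj₁ (proj₂ (exists-non-edge G k<n none))
  pairs = filter NonEdge? (cartesianProduct (allFin n) (allFin n))
  top = argmax degSum start pairs
  top-NonEdge : NonEdge top
  top-NonEdge = argmax-all degSum {P = NonEdge}
    (proj₂ (proj₂ (exists-non-edge G k<n none))) (all-filter NonEdge? (cartesianProduct (allFin n) (allFin n)))
  top-max : ∀ u v → u ≢ v → adj G u v ≡ false → deg G u + deg G v ≤ degSum top
  top-max u v u≢v u≁v = All.lookup (f[xs]≤f[argmax] {f = degSum} start pairs)
    (∈-filter⁺ NonEdge? (∈-cartesianProduct⁺ (∈-allFin u) (∈-allFin v)) (u≢v , u≁v))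
  k≤n : k ≤ n
  k≤n = ≤-trans (m≤m+n k 1) k<n
  finish : ∀ u v → deg G u ≤ deg G v → deg G u + deg G v < k →
           (∀ w → w ≢ v → adj G v w ≡ false → deg G w + deg G v ≤ deg G u + deg G v) →
           ∃ λ h → h + h < k × (∀ r → numKs (suc r) G ≤ cliques n k r h)
  finish u v u≤v deg< max = deg G u , ≤-<-trans (+-monoʳ-≤ (deg G u) u≤v) deg< ,
    numKs-max-pair G k≤n deg< (λ w w≢v v≁w → +-cancelʳ-≤ (deg G v) _ _ (max w w≢v v≁w))
  go : deg G (proj₁ top) ≤ deg G (proj₂ top) ⊎ deg G (proj₂ top) ≤ deg G (proj₁ top) →
       ∃ λ h → h + h < k × (∀ r → numKs (suc r) G ≤ cliques n k r h)
  go (inj₁ le) = finish _ _ le (closed _ _ (proj₁ top-NonEdge) (proj₂ top-NonEdge))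
    (λ w w≢ ≁w → top-max w _ w≢ (trans (SimpleGraph.sym G w _) ≁w))
  go (inj₂ le) = finish _ _ le
    (subst (_< k) (+-comm (deg G (proj₁ top)) _) (closed _ _ (proj₁ top-NonEdge) (proj₂ top-NonEdge)))
    (λ w w≢ ≁w → ≤-trans (top-max w _ w≢ (trans (SimpleGraph.sym G w _) ≁w))
                   (≤-reflexive (+-comm (deg G (proj₁ top)) _)))

-- Convexity and the upper bound.

-- The increment of `F` at `j` is `B j` - `A j`, written without subtraction, and it is
-- nondecreasing. If it is at most 0 at `h`, then `F` does not increase on the way from 0 to `h`;
-- otherwise `F` does not decrease from `h` to `H`.
convex-≤-endpoints : (F A B : ℕ → ℕ) (H : ℕ) →
  (∀ j → j < H → F (suc j) + A j ≡ F j + B j) →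
  (∀ {i j} → i ≤ j → A j ≤ A i) → (∀ {i j} → i ≤ j → B i ≤ B j) →
  ∀ h → h ≤ H → F h ≤ F 0 ⊔ F H
convex-≤-endpoints F A B H step A-anti B-mono h h≤H with ≤-total (B h) (A h)
... | inj₁ B≤A = m≤n⇒m≤n⊔o (F H) (descend h ≤-refl)
  where
  descend : ∀ j → j ≤ h → F j ≤ F 0
  descend zero    _   = ≤-refl
  descend (suc j) j<h = ≤-trans (+-cancelʳ-≤ (A j) _ _ (begin
    F (suc j) + A j ≡⟨ step j (≤-trans j<h h≤H) ⟩
    F j + B j       ≤⟨ +-monoʳ-≤ (F j) (≤-trans (B-mono (<⇒≤ j<h)) (≤-trans B≤A (A-anti (<⇒≤ j<h)))) ⟩
    F j + A j       ∎)) (descend j (<⇒≤ j<h))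
    where open ≤-Reasoning
... | inj₂ A≤B = m≤n⇒m≤o⊔n (F 0) (ascend (≤⇒≤′ h≤H) ≤-refl)
  where
  ascend : ∀ {j} → h ≤′ j → j ≤ H → F h ≤ F j
  ascend ≤′-refl _ = ≤-refl
  ascend {suc j} (≤′-step h≤′j) j<H = ≤-trans (ascend h≤′j (<⇒≤ j<H)) (+-cancelʳ-≤ (A j) _ _ (begin
    F j + A j       ≤⟨ +-monoʳ-≤ (F j) (≤-trans (A-anti (≤′⇒≤ h≤′j)) (≤-trans A≤B (B-mono (≤′⇒≤ h≤′j)))) ⟩
    F j + B j       ≡⟨ sym (step j j<H) ⟩
    F (suc j) + A j ∎))
    where open ≤-Reasoning

-- Pascal's rule gives the increment of cliques in h; its negative part, which decreases, is moved
-- to the other side.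
cliques-convex : ∀ n k r H → k ≤ n → H ≤ k → ∀ h → h ≤ H →
  cliques n k (suc r) h ≤ cliques n k (suc r) 0 ⊔ cliques n k (suc r) H
cliques-convex n k r H k≤n H≤k = convex-≤-endpoints (cliques n k (suc r))
  (λ j → (k ∸ suc j) C suc r)
  (λ j → suc (n ∸ (k ∸ j)) * (j C r) + j C suc r)
  H step
  (λ i≤j → C-monoˡ-≤ (suc r) (∸-monoʳ-≤ k (s≤s i≤j)))
  (λ i≤j → +-mono-≤ (*-mono-≤ (s≤s (∸-monoʳ-≤ n (∸-monoʳ-≤ k i≤j))) (C-monoˡ-≤ r i≤j)) (C-monoˡ-≤ (suc r) i≤j))
  where
  open ≡-Reasoning
  rearrange : ∀ a b m x y → b + suc m * (x + y) + a ≡ (a + b) + m * y + (suc m * x + y)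
  rearrange = solve-∀
  step : ∀ j → j < H → cliques n k (suc r) (suc j) + (k ∸ suc j) C suc r ≡
                       cliques n k (suc r) j + (suc (n ∸ (k ∸ j)) * (j C r) + j C suc r)
  step j j<H = begin
    c C suc (suc r) + (n ∸ c) * (suc j C suc r) + c C suc r
      ≡⟨ cong₂ (λ a b → c C suc (suc r) + a * b + c C suc r) n∸c (sym (nCk+nC[k+1]≡[n+1]C[k+1] j r)) ⟩
    c C suc (suc r) + suc m * (j C r + j C suc r) + c C suc r
      ≡⟨ rearrange (c C suc r) (c C suc (suc r)) m (j C r) (j C suc r) ⟩
    (c C suc r + c C suc (suc r)) + m * (j C suc r) + (suc m * (j C r) + j C suc r)
      ≡⟨ cong (λ a → a + m * (j C suc r) + (suc m * (j C r) + j C suc r))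
           (trans (nCk+nC[k+1]≡[n+1]C[k+1] c (suc r)) (cong (_C suc (suc r)) (sym k∸j))) ⟩
    cliques n k (suc r) j + (suc m * (j C r) + j C suc r) ∎
    where
    c m : ℕ
    c = k ∸ suc j
    m = n ∸ (k ∸ j)
    j<k : j < k
    j<k = ≤-trans j<H H≤k
    k∸j : k ∸ j ≡ suc c
    k∸j = +-∸-assoc 1 j<k
    n∸c : n ∸ c ≡ suc m
    n∸c = trans (+-∸-assoc 1 (≤-trans (≤-reflexive (sym k∸j)) (≤-trans (m∸n≤m k j) k≤n)))
                (cong (λ x → suc (n ∸ x)) (sym k∸j))

-- The forests have `suc k` edges, so `⌊ k /2⌋` is the right end of the range of h. At h = 0 the
-- second summand of f vanishes because s - 1 ≥ 1, and `suc k` - `⌊ k /2⌋` is the rounded-up half in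
-- `bound`.
bound-cliques : ∀ n k r → bound n (suc k) (suc (suc r)) ≡
  cliques n (suc k) (suc r) 0 ⊔ cliques n (suc k) (suc r) ⌊ k /2⌋
bound-cliques n k r = cong₂ _⊔_
  (sym (trans (cong (suc k C suc (suc r) +_) (*-zeroʳ (n ∸ suc k))) (+-identityʳ _)))
  (cong (λ a → a C suc (suc r) + (n ∸ a) * (⌊ k /2⌋ C suc r)) (sym half))
  where
  half : suc k ∸ ⌊ k /2⌋ ≡ suc ⌈ k /2⌉
  half = trans (cong (_∸ ⌊ k /2⌋) (trans (cong suc (sym (⌊n/2⌋+⌈n/2⌉≡n k))) (sym (+-suc ⌊ k /2⌋ ⌈ k /2⌉))))
               (m+n∸m≡n ⌊ k /2⌋ (suc ⌈ k /2⌉))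

upper-bound : ∀ {n k r} → suc k + 1 ≤ n → (G : SimpleGraph n) → LFree (suc k) G →
  numKs (suc (suc r)) G ≤ bound n (suc k) (suc (suc r))
upper-bound {n} {k} {r} k<n G free
  with closure (missing G) G ≤-refl (LFree⇒NoLinks G (s≤s z≤n) free)
... | H , G⊑H , none , closed with closed-bound H k<n none closed
... | h , 2h<k , numKs≤ = begin
  numKs (suc (suc r)) G        ≤⟨ numKs-mono (suc (suc r)) {G} {H} G⊑H ⟩
  numKs (suc (suc r)) H        ≤⟨ numKs≤ (suc r) ⟩
  cliques n (suc k) (suc r) h  ≤⟨ cliques-convex n (suc k) r ⌊ k /2⌋ (≤-trans (m≤m+n (suc k) 1) k<n)
                                    (m≤n⇒m≤1+n (⌊n/2⌋≤n k)) h h≤ ⟩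
  _                            ≡⟨ sym (bound-cliques n k r) ⟩
  bound n (suc k) (suc (suc r)) ∎
  where
  open ≤-Reasoning
  h≤ : h ≤ ⌊ k /2⌋
  h≤ = ≤-trans (≤-reflexive (n≡⌊n+n/2⌋ h)) (⌊n/2⌋-mono (s≤s⁻¹ 2h<k))

-- Threshold graphs

isOne : ℕ → Bool
isOne 1 = true
isOne _ = false

-- Records whether a path meets the part K_{k-2h}. As a Boolean it stands for a single unit of
-- slack, however many vertices of weight 1 occur.
hasOne : (A → ℕ) → List A → Bool
hasOne f []       = false
hasOne f (x ∷ xs) = isOne (f x) ∨ hasOne f xs

hasOne-∈ : (f : A → ℕ) → ∀ {xs x} → x ∈ xs → f x ≡ 1 → hasOne f xs ≡ true
hasOne-∈ f {_ ∷ xs} (here refl) eq rewrite eq = refl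
hasOne-∈ f {y ∷ xs} (there x∈)  eq rewrite hasOne-∈ f x∈ eq = Bool.∨-zeroʳ (isOne (f y))

𝟙-∨ : ∀ a b → 𝟙 (a ∨ b) ≤ 𝟙 a + 𝟙 b
𝟙-∨ true  b = s≤s z≤n
𝟙-∨ false b = ≤-refl

hasOne-++ : (f : A → ℕ) → ∀ xs ys → 𝟙 (hasOne f (xs ++ ys)) ≤ 𝟙 (hasOne f xs) + 𝟙 (hasOne f ys)
hasOne-++ f []       ys = ≤-refl
hasOne-++ f (x ∷ xs) ys with isOne (f x)
... | true  = s≤s z≤n
... | false = hasOne-++ f xs ys

-- With weights 2 on h vertices, 1 on k − 2h vertices and 0 elsewhere this is the join of K_h with
-- the disjoint union of K_{k−2h} and isolated vertices.
threshold : Vec ℕ n → SimpleGraph n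
threshold w .adj x y = not ⌊ x ≟ y ⌋ ∧ ⌊ 2 ≤? lookup w x + lookup w y ⌋
threshold w .SimpleGraph.sym x y = cong₂ _∧_ (cong not (≟-sym x y))
  (cong (λ a → ⌊ 2 ≤? a ⌋) (+-comm (lookup w x) (lookup w y)))
  where
  ≟-sym : ∀ x y → ⌊ x ≟ y ⌋ ≡ ⌊ y ≟ x ⌋
  ≟-sym x y with y ≟ x
  ... | yes refl = ≟-refl x
  ... | no y≢x   = ⌊⌋-false (x ≟ y) (y≢x ∘ sym)
threshold w .irrefl x = cong (λ b → not b ∧ ⌊ 2 ≤? lookup w x + lookup w x ⌋) (≟-refl x)

threshold-sound : (w : Vec ℕ n) → ∀ x y → adj (threshold w) x y ≡ true → 2 ≤ lookup w x + lookup w y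
threshold-sound w x y eq = ⌊⌋-sound (2 ≤? _) (proj₂ (∧-true {not ⌊ x ≟ y ⌋} eq))

threshold-complete : (w : Vec ℕ n) → ∀ {x y} → x ≢ y → 2 ≤ lookup w x + lookup w y →
                     adj (threshold w) x y ≡ true
threshold-complete w {x} {y} x≢y 2≤ =
  cong₂ _∧_ (cong not (⌊⌋-false (x ≟ y) x≢y)) (⌊⌋-complete (2 ≤? _) 2≤)

module _ (w : Vec ℕ n) (w≤2 : ∀ x → lookup w x ≤ 2) where

  private
    f : Fin n → ℕ
    f = lookup w

  -- A vertex of weight 1, and an initial vertex of weight 2, each leave one unit of weight over;
  -- the latter is what makes the induction go through.
  walk-weight : ∀ x p → IsWalk (threshold w) (x ∷ p) →
                length p + 𝟙 (hasOne f (x ∷ p)) + (f x ∸ 1) ≤ ∑ f (x ∷ p)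
  walk-weight x [] _ with f x | w≤2 x
  ... | 0 | _ = z≤n
  ... | 1 | _ = ≤-refl
  ... | 2 | _ = s≤s z≤n
  ... | suc (suc (suc _)) | s≤s (s≤s ())
  walk-weight x (y ∷ p) (x~y , walk) with f x | w≤2 x | threshold-sound w x y x~y | walk-weight y p walk
  -- The neighbour `y` has weight 2, and its spare unit as initial vertex pays for the edge xy.
  ... | 0 | _ | 2≤ | ih = begin
    suc (length p) + 𝟙 (hasOne f (y ∷ p)) + 0
      ≡⟨ rearrange (length p) (𝟙 (hasOne f (y ∷ p))) ⟩
    length p + 𝟙 (hasOne f (y ∷ p)) + 1
      ≤⟨ +-monoʳ-≤ _ (∸-monoˡ-≤ 1 2≤) ⟩
    length p + 𝟙 (hasOne f (y ∷ p)) + (f y ∸ 1)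
      ≤⟨ ih ⟩
    ∑ f (y ∷ p) ∎
    where
    open ≤-Reasoning
    rearrange : ∀ a b → suc a + b + 0 ≡ a + b + 1
    rearrange = solve-∀
  -- The weight of `x` accounts for its own unit of slack. The edge xy is paid by the slack of `y`
  -- if `y` has weight 1, and by its spare unit if it has weight 2.
  ... | 1 | _ | s≤s 1≤ | ih = s≤s (begin
    length p + 1 + 0
      ≡⟨ trans (+-identityʳ _) (+-comm (length p) 1) ⟩
    suc (length p)
      ≤⟨ slack 1≤ ih ⟩
    ∑ f (y ∷ p) ∎)
    where
    open ≤-Reasoning
    slack : 1 ≤ f y → length p + 𝟙 (hasOne f (y ∷ p)) + (f y ∸ 1) ≤ ∑ f (y ∷ p) →
            suc (length p) ≤ ∑ f (y ∷ p)
    slack 1≤ ih with f y | 1≤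
    ... | 1 | _ = ≤-trans (≤-reflexive (sym (trans (+-identityʳ _) (+-comm (length p) 1)))) ih
    ... | suc (suc a) | _ = ≤-trans
      (≤-trans (m≤m+n (suc (length p)) _) (≤-reflexive (rearrange (length p) (𝟙 (hasOne f p)) a))) ih
      where
      rearrange : ∀ l b a → suc l + (b + a) ≡ l + b + suc a
      rearrange = solve-∀
  -- Of the two units at `x`, one pays for the edge xy and one is the spare unit of the new initial
  -- vertex.
  ... | 2 | _ | _ | ih = begin
    suc (length p) + 𝟙 (hasOne f (y ∷ p)) + 1
      ≡⟨ +-comm _ 1 ⟩
    2 + (length p + 𝟙 (hasOne f (y ∷ p)))
      ≤⟨ +-monoʳ-≤ 2 (≤-trans (m≤m+n _ (f y ∸ 1)) ih) ⟩
    2 + ∑ f (y ∷ p) ∎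
    where open ≤-Reasoning
  ... | suc (suc (suc _)) | s≤s (s≤s ()) | _ | _

  walks-weight : ∀ ps → AllWalks (threshold w) ps →
    sum (map pathEdges ps) + 𝟙 (hasOne f (concat ps)) ≤ ∑ f (concat ps)
  walks-weight []             _ = z≤n
  walks-weight ([] ∷ ps)      (_ , walks) = walks-weight ps walks
  walks-weight ((x ∷ p) ∷ ps) (walk , walks) = begin
    length p + e + 𝟙 (hasOne f ((x ∷ p) ++ concat ps))
      ≤⟨ +-monoʳ-≤ (length p + e) (hasOne-++ f (x ∷ p) (concat ps)) ⟩
    length p + e + (𝟙 (hasOne f (x ∷ p)) + 𝟙 (hasOne f (concat ps)))
      ≡⟨ rearrange (length p) e (𝟙 (hasOne f (x ∷ p))) _ ⟩
    length p + 𝟙 (hasOne f (x ∷ p)) + (e + 𝟙 (hasOne f (concat ps)))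
      ≤⟨ +-mono-≤ (≤-trans (m≤m+n _ (f x ∸ 1)) (walk-weight x p walk)) (walks-weight ps walks) ⟩
    ∑ f (x ∷ p) + ∑ f (concat ps)
      ≡⟨ sym (∑-++ f (x ∷ p) (concat ps)) ⟩
    ∑ f ((x ∷ p) ++ concat ps) ∎
    where
    open ≤-Reasoning
    e : ℕ
    e = sum (map pathEdges ps)
    rearrange : ∀ a b c d → a + b + (c + d) ≡ a + c + (b + d)
    rearrange = solve-∀

  -- If the paths meet a vertex of weight 1, `walks-weight` is strict. Otherwise `x` lies on no
  -- path, and its own weight makes the total strictly larger.
  threshold-LFree : ∀ x → f x ≡ 1 → LFree (∑ f (allFin n)) (threshold w)
  threshold-LFree x fx≡1 (ps , walks , uniq , edges≡) = <-irrefl edges≡ edges<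
    where
    open ≤-Reasoning
    e : ℕ
    e = sum (map pathEdges ps)
    edges< : e < ∑ f (allFin n)
    edges< with hasOne f (concat ps) in eq | walks-weight ps walks
    ... | true | ih = begin
      suc e            ≡⟨ +-comm 1 e ⟩
      e + 1            ≤⟨ ih ⟩
      ∑ f (concat ps)  ≤⟨ unique-sum-≤ f uniq ⟩
      ∑ f (allFin n)   ∎
    ... | false | ih = begin
      suc e                  ≡⟨ cong suc (sym (+-identityʳ e)) ⟩
      suc (e + 0)            ≤⟨ s≤s ih ⟩
      1 + ∑ f (concat ps)    ≡⟨ cong (_+ ∑ f (concat ps)) (sym fx≡1) ⟩
      ∑ f (x ∷ concat ps)    ≤⟨ unique-sum-≤ f (All.tabulate x≢ ∷ uniq) ⟩
      ∑ f (allFin n)         ∎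
      where
      x≢ : ∀ {y} → y ∈ concat ps → x ≢ y
      x≢ y∈ refl = contradiction (trans (sym eq) (hasOne-∈ f y∈ fx≡1)) λ ()

-- Cliques in threshold graphs.

-- These vertices are adjacent to all others, whatever the weights of the latter.
core : Vec ℕ n → Vec Bool n
core = Vec.map (λ a → ⌊ 2 ≤? a ⌋)

core-sound : (w : Vec ℕ n) → ∀ x → lookup (core w) x ≡ true → 2 ≤ lookup w x
core-sound w x eq = ⌊⌋-sound (2 ≤? lookup w x) (trans (sym (lookup-map x _ w)) eq)

-- The new vertex of weight 0 forms a clique with any `s` vertices of the core, and the old cliques
-- persist because the old weights do.
numKs-threshold-0∷ : (w : Vec ℕ n) → ∀ s →
  size (core w) C s + numKs (suc s) (threshold w) ≤ numKs (suc s) (threshold (0 ∷ w))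
numKs-threshold-0∷ {n} w s = begin
  size (core w) C s + numKs (suc s) (threshold w)
    ≡⟨ cong₂ _+_ (sym (count-subsets (core w) s)) (numKs-∑ (suc s) (threshold w)) ⟩
  ∑ (𝟙 ∘ isSubset s (core w)) (allSubsets n) + ∑ (𝟙 ∘ isKsCopy (suc s) (threshold w)) (allSubsets n)
    ≤⟨ +-mono-≤ (∑-mono (λ S → 𝟙-mono (with-new S)) (allSubsets n))
                (∑-mono (λ S → 𝟙-mono (without-new S)) (allSubsets n)) ⟩
  ∑ (copy ∘ (true ∷_)) (allSubsets n) + ∑ (copy ∘ (false ∷_)) (allSubsets n)
    ≡⟨ sym (∑-allSubsets copy) ⟩
  ∑ copy (allSubsets (suc n))
    ≡⟨ sym (numKs-∑ (suc s) G) ⟩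
  numKs (suc s) G ∎
  where
  open ≤-Reasoning
  G : SimpleGraph (suc n)
  G = threshold (0 ∷ w)
  copy : Vec Bool (suc n) → ℕ
  copy S = 𝟙 (isKsCopy (suc s) G S)
  with-new : ∀ S → isSubset s (core w) S ≡ true → isKsCopy (suc s) G (true ∷ S) ≡ true
  with-new S eq with isSubset-sound s (core w) S eq
  ... | size≡ , S⊆ = isKsCopy-complete (suc s) G (true ∷ S) (cong suc size≡) clique
    where
    heavy : ∀ x → lookup S x ≡ true → 2 ≤ lookup w x
    heavy x x∈ = core-sound w x (S⊆ x x∈)
    clique : Clique G (true ∷ S)
    clique zero    zero    _  _  0≢0 = contradiction refl 0≢0
    clique zero    (suc v) _  v∈ u≢v = threshold-complete (0 ∷ w) u≢v (heavy v v∈)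
    clique (suc u) zero    u∈ _  u≢v = threshold-complete (0 ∷ w) u≢v (≤-trans (heavy u u∈) (m≤m+n _ 0))
    clique (suc u) (suc v) u∈ _  u≢v = threshold-complete (0 ∷ w) u≢v (≤-trans (heavy u u∈) (m≤m+n _ _))
  without-new : ∀ S → isKsCopy (suc s) (threshold w) S ≡ true → isKsCopy (suc s) G (false ∷ S) ≡ true
  without-new S eq with isKsCopy-sound (suc s) (threshold w) S eq
  ... | size≡ , clique = isKsCopy-complete (suc s) G (false ∷ S) size≡ clique′
    where
    clique′ : Clique G (false ∷ S)
    clique′ (suc u) (suc v) u∈ v∈ u≢v = threshold-complete (0 ∷ w) u≢v
      (threshold-sound w u v (clique u v u∈ v∈ (u≢v ∘ cong suc)))

size-replicate-true : ∀ n → size (Vec.replicate n true) ≡ n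
size-replicate-true zero    = refl
size-replicate-true (suc n) = cong suc (size-replicate-true n)

-- Two positive weights add up to at least 2, so the graph is complete.
numKs-threshold-positive : (w : Vec ℕ n) → (∀ x → 1 ≤ lookup w x) → ∀ s →
  n C s ≤ numKs s (threshold w)
numKs-threshold-positive {n} w 1≤w s = begin
  n C s
    ≡⟨ cong (_C s) (sym (size-replicate-true n)) ⟩
  size (Vec.replicate n true) C s
    ≡⟨ sym (count-subsets (Vec.replicate n true) s) ⟩
  ∑ (𝟙 ∘ isSubset s (Vec.replicate n true)) (allSubsets n)
    ≤⟨ ∑-mono (λ S → 𝟙-mono (copy S)) (allSubsets n) ⟩
  ∑ (𝟙 ∘ isKsCopy s (threshold w)) (allSubsets n)
    ≡⟨ sym (numKs-∑ s (threshold w)) ⟩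
  numKs s (threshold w) ∎
  where
  open ≤-Reasoning
  copy : ∀ S → isSubset s (Vec.replicate n true) S ≡ true → isKsCopy s (threshold w) S ≡ true
  copy S eq = isKsCopy-complete s (threshold w) S (proj₁ (isSubset-sound s _ S eq))
    λ u v _ _ u≢v → threshold-complete w u≢v (+-mono-≤ (1≤w u) (1≤w v))

size-core-pad : ∀ m (w : Vec ℕ n) → size (core (Vec.replicate m 0 Vec.++ w)) ≡ size (core w)
size-core-pad zero    w = refl
size-core-pad (suc m) w = size-core-pad m w

numKs-threshold-pad : ∀ m (w : Vec ℕ n) → (∀ x → 1 ≤ lookup w x) → ∀ s →
  n C suc s + m * (size (core w) C s) ≤ numKs (suc s) (threshold (Vec.replicate m 0 Vec.++ w))
numKs-threshold-pad zero    w 1≤w s =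
  ≤-trans (≤-reflexive (+-identityʳ _)) (numKs-threshold-positive w 1≤w (suc s))
numKs-threshold-pad {n} (suc m) w 1≤w s = begin
  n C suc s + (c + m * c)
    ≡⟨ rearrange (n C suc s) c (m * c) ⟩
  c + (n C suc s + m * c)
    ≤⟨ +-monoʳ-≤ c (numKs-threshold-pad m w 1≤w s) ⟩
  c + numKs (suc s) (threshold w′)
    ≡⟨ cong (λ a → a C s + numKs (suc s) (threshold w′)) (sym (size-core-pad m w)) ⟩
  size (core w′) C s + numKs (suc s) (threshold w′)
    ≤⟨ numKs-threshold-0∷ w′ s ⟩
  numKs (suc s) (threshold (0 ∷ w′)) ∎
  where
  open ≤-Reasoning
  c : ℕ
  c = size (core w) C s
  w′ : Vec ℕ (m + n)
  w′ = Vec.replicate m 0 Vec.++ w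
  rearrange : ∀ a b c → a + (b + c) ≡ b + (a + c)
  rearrange = solve-∀

-- The extremal graphs.

total : Vec ℕ n → ℕ
total {n} w = ∑ (lookup w) (allFin n)

total-pad : ∀ m a (w : Vec ℕ n) → total (Vec.replicate m a Vec.++ w) ≡ m * a + total w
total-pad zero    a w = refl
total-pad (suc m) a w = trans (∑-allFin (lookup (a ∷ Vec.replicate m a Vec.++ w)))
  (trans (cong (a +_) (total-pad m a w)) (sym (+-assoc a (m * a) _)))

total-replicate : ∀ m a → total (Vec.replicate m a) ≡ m * a
total-replicate zero    a = refl
total-replicate (suc m) a = trans (∑-allFin (lookup (a ∷ Vec.replicate m a))) (cong (a +_) (total-replicate m a))

all-replicate : {P : A → Set} {x : A} → ∀ m → P x → VecAll.All P (Vec.replicate m x)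
all-replicate zero    px = []
all-replicate (suc m) px = px ∷ all-replicate m px

size-core-weights : ∀ q h → size (core (Vec.replicate q 1 Vec.++ Vec.replicate h 2)) ≡ h
size-core-weights zero    zero    = refl
size-core-weights zero    (suc h) = cong suc (size-core-weights zero h)
size-core-weights (suc q) h       = size-core-weights q h

-- The weights 0, 1, 2 occur `m`, `suc q` and `h` times and total `k`. Writing the middle count as a
-- successor provides the vertex `m ↑ʳ zero` of weight 1 that `threshold-LFree` asks for.
extremal : ∀ {n k c} m q h r → n ≡ m + c → c ≡ suc q + h → k ≡ suc q + (h + h) →
  Σ (SimpleGraph n) λ G → LFree k G × c C suc r + m * (h C r) ≤ numKs (suc r) G
extremal {k = k} m q h r refl refl k≡ = threshold w ,
  subst (λ j → LFree j (threshold w)) total≡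
    (threshold-LFree w (λ x → VecAll.lookup w≤2 (∈-lookup x w)) (m ↑ʳ zero) (lookup-++ʳ (Vec.replicate m 0) w₀ zero)) ,
  subst (λ j → (suc q + h) C suc r + m * (j C r) ≤ numKs (suc r) (threshold w))
    (size-core-weights (suc q) h)
    (numKs-threshold-pad m w₀ (λ x → VecAll.lookup 1≤w₀ (∈-lookup x w₀)) r)
  where
  w₀ : Vec ℕ (suc q + h)
  w₀ = Vec.replicate (suc q) 1 Vec.++ Vec.replicate h 2
  w : Vec ℕ (m + (suc q + h))
  w = Vec.replicate m 0 Vec.++ w₀
  w≤2 : VecAll.All (_≤ 2) w
  w≤2 = ++⁺ (all-replicate m z≤n) (++⁺ (all-replicate (suc q) (s≤s z≤n)) (all-replicate h ≤-refl))
  1≤w₀ : VecAll.All (1 ≤_) w₀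
  1≤w₀ = ++⁺ (all-replicate (suc q) ≤-refl) (all-replicate h (s≤s z≤n))
  arith : ∀ m q h → m * 0 + (q * 1 + h * 2) ≡ q + (h + h)
  arith = solve-∀
  total≡ : total w ≡ k
  total≡ = trans (total-pad m 0 w₀) (trans (cong (m * 0 +_) (trans (total-pad (suc q) 1 (Vec.replicate h 2))
    (cong (suc q * 1 +_) (total-replicate h 2)))) (trans (arith m (suc q) h) (sym k≡)))

lower-bound : ∀ n k r h → h + h < k → k ≤ n →
  Σ (SimpleGraph n) λ G → LFree k G × cliques n k r h ≤ numKs (suc r) G
lower-bound n k r h 2h<k k≤n = extremal (n ∸ (k ∸ h)) q h r
  (sym (m∸n+n≡m (≤-trans (m∸n≤m k h) k≤n)))
  (trans (cong (_∸ h) (trans k≡ (sym (+-assoc (suc q) h h)))) (m+n∸n≡m (suc q + h) h)) k≡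
  where
  q : ℕ
  -- Thus `suc q` is k - 2h, positive by 2h < `k`.
  q = k ∸ suc (h + h)
  k≡ : k ≡ suc q + (h + h)
  k≡ = trans (sym (m∸n+n≡m 2h<k)) (+-suc q (h + h))

-- The extremal number.

theorem1p5 : (n k s : ℕ) → 2 ≤ s → 1 ≤ k → k + 1 ≤ n →
    ((G : SimpleGraph n) → LFree k G → numKs s G ≤ bound n k s)
    × Σ (SimpleGraph n) (λ G → LFree k G × numKs s G ≡ bound n k s)
theorem1p5 n (suc k) (suc (suc r)) (s≤s (s≤s z≤n)) _ k<n = upper-bound k<n , attained
  where
  Attains : ℕ → Set
  Attains N = Σ (SimpleGraph n) λ G → LFree (suc k) G × N ≤ numKs (suc (suc r)) G
  lower : ∀ h → h + h < suc k → Attains (cliques n (suc k) (suc r) h)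
  lower h 2h<k = lower-bound n (suc k) (suc r) h 2h<k (≤-trans (m≤m+n (suc k) 1) k<n)
  halves : ⌊ k /2⌋ + ⌊ k /2⌋ < suc k
  halves = s≤s (≤-trans (+-monoʳ-≤ ⌊ k /2⌋ (⌊n/2⌋≤⌈n/2⌉ k)) (≤-reflexive (⌊n/2⌋+⌈n/2⌉≡n k)))
  -- The maximum equals f at one of the two ends, and the threshold graph for that end reaches it.
  best : Attains (bound n (suc k) (suc (suc r)))
  best with ⊔-sel (cliques n (suc k) (suc r) 0) (cliques n (suc k) (suc r) ⌊ k /2⌋)
  ... | inj₁ eq = subst Attains (sym (trans (bound-cliques n k r) eq)) (lower 0 (s≤s z≤n))
  ... | inj₂ eq = subst Attains (sym (trans (bound-cliques n k r) eq)) (lower ⌊ k /2⌋ halves)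
  attained : Σ (SimpleGraph n) λ G → LFree (suc k) G × numKs (suc (suc r)) G ≡ bound n (suc k) (suc (suc r))
  attained with best
  ... | G , free , ≤numKs = G , free , ≤-antisym (upper-bound k<n G free) ≤numKs
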